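{- Let $N\ge 1$ be an integer and assume the prime $2N$-tuplets conjecture TC($2N$). Let $g$ be an integer with $g\ne -1$ and $g$ not a perfect square. Then there exist integers $A_1$ and $C_1$ such that $A_1n^2+C_1$ is prime for $n=1,\dots,N$ and $g$ is a primitive root modulo each of these primes.
   Context: TC($k$) is the statement: for all integers $A_1,\dots,A_k,B_1,\dots,B_k$ with $A_j>0$ such that for every prime $p$ there is an integer $n_p$ with $p\nmid\prod_{j=1}^k(A_jn_p+B_j)$, there exist infinitely many integers $n$ such that $A_jn+B_j$ is prime for all $1\le j\le k$. -}

module Defs where

open import Data.Nat as ℕ using (ℕ; zero; suc)
open import Data.Nat.Primality using (Prime)
open import Data.Integer as ℤ using (ℤ; +_; _+_; _-_; _*_; _^_; ∣_∣)
open import Data.Integer.Divisibility using (_∣_)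
open import Data.Fin using (Fin; zero; suc)
open import Data.Product using (Σ; _×_; ∃; ∃-syntax)
open import Relation.Nullary using (¬_)
open import Relation.Binary.PropositionalEquality using (_≡_)

IsPrimeℤ : ℤ → Set
IsPrimeℤ z = Σ ℕ λ p → Prime p × (z ≡ + p)

∏ : (k : ℕ) → (Fin k → ℤ) → ℤ
∏ zero    f = + 1
∏ (suc k) f = f zero * ∏ k (λ j → f (suc j))

Admissible : (k : ℕ) → (Fin k → ℤ) → (Fin k → ℤ) → Set
Admissible k A B =
  (p : ℕ) → Prime p → ∃[ np ] ¬ ((+ p) ∣ ∏ k (λ j → A j * np + B j))

-- TC(k): prime k-tuplets conjecture. "Infinitely many integers n" is
-- rendered as: for every bound M there is such an n with |n| ≥ M.
TC : ℕ → Set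
TC k = (A B : Fin k → ℤ) → ((j : Fin k) → + 0 ℤ.< A j) → Admissible k A B →
       (M : ℕ) → ∃[ n ] ((M ℕ.≤ ∣ n ∣) × ((j : Fin k) → IsPrimeℤ (A j * n + B j)))

PrimitiveRoot : ℤ → ℕ → Set
PrimitiveRoot g p =
  ((+ p) ∣ (g ^ (p ℕ.∸ 1) - + 1)) ×
  ((k : ℕ) → 1 ℕ.≤ k → k ℕ.< p ℕ.∸ 1 → ¬ ((+ p) ∣ (g ^ k - + 1)))

IsSquareℤ : ℤ → Set
IsSquareℤ g = ∃[ m ] (g ≡ m * m)

{-# OPTIONS --safe #-}
-- Look for primes pₙ = 1 + 2ᵃ qₙ with qₙ = M (n² + x) + r also prime, where M is divisible by every prime up
-- to 2N; TC(2N) supplies x as soon as r and c = 1 + 2ᵃ r are coprime to M.  If g is a quadratic nonresidue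
-- modulo pₙ, its order is divisible by 2ᵃ, so it is 2ᵃ or pₙ - 1; the former is impossible for large x since
-- then pₙ would divide g^(2ᵃ) - 1.  As pₙ ≡ c modulo 2ᵃ M, reciprocity turns nonresiduacity of g into a choice
-- of r.  Write |g| = d s² with d squarefree.
--   d = 1:  g = -s², and a = 1 with r odd gives pₙ ≡ 3 modulo 4.
--   d = 2:  a = 2 with r odd gives pₙ ≡ 5 modulo 8.
--   else:   a = 3 and c is a nonresidue modulo one odd prime l ∣ d and ≡ 9, a square, modulo the others.
-- Modulo 3 the conditions 3 ∤ r and 3 ∤ c force c ≡ 2, so 3 is a nonresidue modulo pₙ when a ≥ 2; hence
-- l = 3 is taken if 3 ∣ d.
module Submission where

open import Defs
open import Data.Empty using (⊥)
open import Data.Fin as Fin using (Fin; zero; suc; toℕ; fromℕ<; punchOut; combine; remQuot)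
open import Data.Fin.Permutation as Perm using (permutation)
import Data.Fin.Properties as Fin
open import Data.Integer as ℤ using (ℤ; +_; -[1+_]; _+_; _*_; _-_; -_; _^_; ∣_∣; 0ℤ; 1ℤ; -1ℤ)
open import Data.Integer.Divisibility.Signed as ℤ∣ using (divides; ∣ᵤ⇒∣; ∣⇒∣ᵤ)
import Data.Integer.Divisibility as ℤᵤ
import Data.Integer.Properties as ℤ
open import Data.Integer.Tactic.RingSolver using () renaming (solve-∀ to ℤ-ring)
open import Data.List using (List; []; _∷_; length; replicate)
open import Data.List.Membership.Propositional using (_∈_; _∉_)
open import Data.List.Properties using (length-replicate)
open import Data.List.Relation.Unary.All as All using (All; []; _∷_)
open import Data.List.Relation.Unary.Any using (here; there)
open import Data.Nat as ℕ using (ℕ; zero; suc; NonZero; s≤s; z≤n)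
import Data.Nat.Coprimality as Coprime
import Data.Nat.Divisibility as ℕ∣
open import Data.Nat.DivMod using (m≡m%n+[m/n]*n; m%n<n; m*n/n≡m; m/n*n≤m; m<n⇒m/n≡0; m<n*o⇒m/o<n; /-monoˡ-≤; +-distrib-/-∣ʳ)
open import Data.Nat.GCD using (gcd; gcd-GCD; gcd[m,n]∣m; gcd[m,n]∣n; module Bézout)
open import Data.Nat.Induction using (<-rec)
open import Data.Nat.ListAction using (product)
open import Data.Nat.Primality
open import Data.Nat.Primality.Factorisation using (PrimeFactorisation; factorise)
import Data.Nat.Properties as ℕ
open import Data.List.Membership.DecPropositional ℕ._≟_ using (_∈?_)
open import Data.Nat.Tactic.RingSolver using () renaming (solve-∀ to ℕ-ring)
open import Data.Product using (Σ; _×_; _,_; ∃-syntax; proj₁; proj₂)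
open import Data.Sum as Sum using (_⊎_; inj₁; inj₂; [_,_]′)
open import Function using (_∘_; id)
open import Function.Definitions using (Injective)
open import Relation.Binary.Bundles using (Setoid)
import Relation.Binary.Reasoning.Setoid as SetoidReasoning
open import Relation.Binary.PropositionalEquality
open import Relation.Nullary.Decidable using (from-yes; from-no)
open import Relation.Nullary using (¬_; Dec; yes; no; contradiction; ¬?; _×-dec_)
open import Algebra.Properties.CommutativeMonoid.Sum ℤ.*-1-commutativeMonoid using ()
  renaming ( sum to prod; sum-permute to prod-permute; ∑-distrib-+ to prod-distrib-*
           ; ∑-comm to prod-comm; sum-cong-≗ to prod-cong )

-- Every n contributes two linear forms in x, one for qₙ and one for pₙ, hence the 2N-tuplets. As n
-- enters only through n² + x, all pₙ are values of one polynomial A₁ n² + C₁. The exponent `a` of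
-- the code is one less than that of the overview: p - 1 = 2ᵃ⁺¹ q, so (p - 1)/2 = 2ᵃ q. The square 9
-- is chosen for coprimality: c ≡ 1 modulo a prime l would make l divide r, whereas 9 - 1 = 8 is a
-- multiple of 2, 4 and 8, so r can be a power of 2 modulo l. Legendre symbols appear as powers:
-- (a/p) is the class of a to the power h, where p = 1 + 2h. Gauss's lemma evaluates this power as a
-- product of signs; Fermat's theorem, the character of 2 and reciprocity are all read off from it.
-- Reciprocity is needed only for p ≡ 1 modulo 4, where the two symbols agree.

infix 4 _≡_[mod_]

-- Congruences of integers and finite products.

record _≡_[mod_] (a b m : ℤ) : Set where
  constructor mod
  field diff : m ℤ∣.∣ a - b

open _≡_[mod_] using (diff)

module _ {m : ℤ} where

  ≡mod-by : ∀ {a b} c → a ≡ b + c * m → a ≡ b [mod m ]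
  ≡mod-by {a} {b} c eq = mod (divides c (trans (cong (_- b) eq) (cancel b (c * m))))
    where
    cancel : ∀ b x → b + x - b ≡ x
    cancel = ℤ-ring

  ≡mod-reflexive : ∀ {a b} → a ≡ b → a ≡ b [mod m ]
  ≡mod-reflexive {a} refl = mod (divides 0ℤ (ℤ.+-inverseʳ a))

  ≡mod-refl : ∀ {a} → a ≡ a [mod m ]
  ≡mod-refl = ≡mod-reflexive refl

  ≡mod-sym : ∀ {a b} → a ≡ b [mod m ] → b ≡ a [mod m ]
  ≡mod-sym {a} {b} (mod d) = mod (subst (m ℤ∣.∣_) (flip a b) (ℤ∣.∣m⇒∣-m d))
    where
    flip : ∀ a b → - (a - b) ≡ b - a
    flip = ℤ-ring

  ≡mod-trans : ∀ {a b c} → a ≡ b [mod m ] → b ≡ c [mod m ] → a ≡ c [mod m ]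
  ≡mod-trans {a} {b} {c} (mod d) (mod e) =
    mod (subst (m ℤ∣.∣_) (telescope a b c) (ℤ∣.∣m∣n⇒∣m+n d e))
    where
    telescope : ∀ a b c → (a - b) + (b - c) ≡ a - c
    telescope = ℤ-ring

  +-cong-mod : ∀ {a b c d} → a ≡ b [mod m ] → c ≡ d [mod m ] → a + c ≡ b + d [mod m ]
  +-cong-mod {a} {b} {c} {d} (mod x) (mod y) =
    mod (subst (m ℤ∣.∣_) (regroup a b c d) (ℤ∣.∣m∣n⇒∣m+n x y))
    where
    regroup : ∀ a b c d → (a - b) + (c - d) ≡ (a + c) - (b + d)
    regroup = ℤ-ring

  *-cong-mod : ∀ {a b c d} → a ≡ b [mod m ] → c ≡ d [mod m ] → a * c ≡ b * d [mod m ]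
  *-cong-mod {a} {b} {c} {d} (mod x) (mod y) =
    mod (subst (m ℤ∣.∣_) (regroup a b c d) (ℤ∣.∣m∣n⇒∣m+n (ℤ∣.∣n⇒∣m*n c x) (ℤ∣.∣n⇒∣m*n b y)))
    where
    regroup : ∀ a b c d → c * (a - b) + b * (c - d) ≡ a * c - b * d
    regroup = ℤ-ring

  *-congˡ-mod : ∀ c {a b} → a ≡ b [mod m ] → c * a ≡ c * b [mod m ]
  *-congˡ-mod c = *-cong-mod (≡mod-refl {a = c})

  ^-cong-mod : ∀ {a b} n → a ≡ b [mod m ] → a ^ n ≡ b ^ n [mod m ]
  ^-cong-mod zero    a≡b = ≡mod-refl
  ^-cong-mod (suc n) a≡b = *-cong-mod a≡b (^-cong-mod n a≡b)

  ∣⇒≡0 : ∀ {a} → m ℤ∣.∣ a → a ≡ 0ℤ [mod m ]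
  ∣⇒≡0 {a} d = mod (subst (m ℤ∣.∣_) (sym (ℤ.+-identityʳ a)) d)

  ≡0⇒∣ : ∀ {a} → a ≡ 0ℤ [mod m ] → m ℤ∣.∣ a
  ≡0⇒∣ {a} (mod d) = subst (m ℤ∣.∣_) (ℤ.+-identityʳ a) d

≡mod-setoid : ℤ → Setoid _ _
≡mod-setoid m = record
  { Carrier = ℤ ; _≈_ = _≡_[mod m ]
  ; isEquivalence = record { refl = ≡mod-refl ; sym = ≡mod-sym ; trans = ≡mod-trans } }

module ≡mod-Reasoning (m : ℤ) = SetoidReasoning (≡mod-setoid m)

prod-cong-mod : ∀ {m n} {f g : Fin n → ℤ} → (∀ i → f i ≡ g i [mod m ]) → prod f ≡ prod g [mod m ]
prod-cong-mod {n = zero}  f≡g = ≡mod-refl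
prod-cong-mod {n = suc n} f≡g = *-cong-mod (f≡g zero) (prod-cong-mod (f≡g ∘ suc))

prod-const : ∀ n c → prod {n} (λ _ → c) ≡ c ^ n
prod-const zero    c = refl
prod-const (suc n) c = cong (c *_) (prod-const n c)

injective⇒permutation : ∀ {n} (f : Fin n → Fin n) → Injective _≡_ _≡_ f →
                        ∃[ π ] (∀ i → π Perm.⟨$⟩ʳ i ≡ f i)
injective⇒permutation {n} f f-inj = permutation f f⁻¹ f∘f⁻¹ (λ i → f-inj (f∘f⁻¹ (f i))) , λ _ → refl
  where
  surjective : ∀ {n} (f : Fin n → Fin n) → Injective _≡_ _≡_ f → ∀ j → ∃[ i ] f i ≡ j
  surjective {suc n} f f-inj j with Fin.any? (λ i → f i Fin.≟ j)
  ... | yes ∃i = ∃i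
  -- If `j` were missed, deleting it from the codomain would give an injection from `Fin (suc n)`
  -- into `Fin n`.
  ... | no ∄i = contradiction
    (λ {i} {i′} eq → f-inj (Fin.punchOut-injective (λ e → ∄i (i , sym e)) (λ e → ∄i (i′ , sym e)) eq))
    (Fin.<⇒notInjective {f = λ i → punchOut {i = j} (λ e → ∄i (i , sym e))} ℕ.≤-refl)
  f⁻¹ : Fin n → Fin n
  f⁻¹ j = proj₁ (surjective f f-inj j)
  f∘f⁻¹ : ∀ j → f (f⁻¹ j) ≡ j
  f∘f⁻¹ j = proj₂ (surjective f f-inj j)

prod-injective : ∀ {n} (f : Fin n → ℤ) (σ : Fin n → Fin n) → Injective _≡_ _≡_ σ →
                 prod (f ∘ σ) ≡ prod f
prod-injective f σ σ-inj with π , π≗σ ← injective⇒permutation σ σ-inj =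
  sym (trans (prod-permute f π) (prod-cong (cong f ∘ π≗σ)))

-- Parity signs and cancellation modulo a prime.

opaque
  -- Parity is carried by signs: `n` is odd exactly when `ε n ≡ -1ℤ`.
  ε : ℕ → ℤ
  ε n = -1ℤ ^ n

  ε-0 : ε 0 ≡ 1ℤ
  ε-0 = refl

  ε-suc : ∀ n → ε (suc n) ≡ -1ℤ * ε n
  ε-suc n = refl

  ε-+ : ∀ m n → ε (m ℕ.+ n) ≡ ε m * ε n
  ε-+ = ℤ.^-distribˡ-+-* -1ℤ

  ε-* : ∀ m n → ε (m ℕ.* n) ≡ ε m ^ n
  ε-* m n = sym (ℤ.^-*-assoc -1ℤ m n)

  ε-double : ∀ n → ε (2 ℕ.* n) ≡ 1ℤ
  ε-double n = trans (ε-* 2 n) (ℤ.^-zeroˡ n)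

  -1^≡ε : ∀ n → -1ℤ ^ n ≡ ε n
  -1^≡ε n = refl

ε-square : ∀ n → ε n * ε n ≡ 1ℤ
ε-square n = trans (sym (ε-+ n n)) (trans (cong (λ x → ε (n ℕ.+ x)) (sym (ℕ.+-identityʳ n))) (ε-double n))

ε≡±1 : ∀ n → ε n ≡ 1ℤ ⊎ ε n ≡ -1ℤ
ε≡±1 zero = inj₁ ε-0
ε≡±1 (suc n) with ε≡±1 n
... | inj₁ eq = inj₂ (trans (ε-suc n) (cong (-1ℤ *_) eq))
... | inj₂ eq = inj₁ (trans (ε-suc n) (cong (-1ℤ *_) eq))

euclidsLemma-ℤ : ∀ {p} → Prime p → ∀ x y → + p ℤ∣.∣ x * y → + p ℤ∣.∣ x ⊎ + p ℤ∣.∣ y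
euclidsLemma-ℤ {p} pp x y d =
  Sum.map ∣ᵤ⇒∣ ∣ᵤ⇒∣ (euclidsLemma ∣ x ∣ ∣ y ∣ pp (subst (p ℕ∣.∣_) (ℤ.abs-* x y) (∣⇒∣ᵤ d)))

*-cancelˡ-mod : ∀ {p} → Prime p → ∀ c {x y} → ¬ + p ℤ∣.∣ c → c * x ≡ c * y [mod + p ] → x ≡ y [mod + p ]
*-cancelˡ-mod {p} pp c {x} {y} p∤c (mod d)
  with euclidsLemma-ℤ pp c (x - y) (subst (+ p ℤ∣.∣_) (factor c x y) d)
  where
  factor : ∀ c x y → c * x - c * y ≡ c * (x - y)
  factor = ℤ-ring
... | inj₁ p∣c   = contradiction p∣c p∤c
... | inj₂ p∣x-y = mod p∣x-y

+≡+⇒≡ : ∀ {p a b} → a ℕ.< p → b ℕ.< p → + a ≡ + b [mod + p ] → a ≡ b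
+≡+⇒≡ {p} {a} {b} a<p b<p a≡b =
  [ (λ a≤b → ordered b<p a≤b (≡mod-sym a≡b)) , (λ b≤a → sym (ordered a<p b≤a a≡b)) ]′ (ℕ.≤-total a b)
  where
  ordered : ∀ {a b} → b ℕ.< p → a ℕ.≤ b → + b ≡ + a [mod + p ] → a ≡ b
  ordered {a} {b} b<p a≤b (mod d) with b ℕ.∸ a in eq
  ... | zero  = ℕ.≤-antisym a≤b (ℕ.m∸n≡0⇒m≤n eq)
  ... | suc c = contradiction (subst (p ℕ∣.∣_) abs-eq (∣⇒∣ᵤ d))
                  (ℕ∣.>⇒∤ (ℕ.≤-<-trans (subst (ℕ._≤ b) eq (ℕ.m∸n≤m b a)) b<p))
    where
    abs-eq : ∣ + b - + a ∣ ≡ suc c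
    abs-eq = trans (cong ∣_∣ (trans (ℤ.m-n≡m⊖n b a) (ℤ.⊖-≥ a≤b))) eq

-- Gauss's lemma.

-- F n = (-1)ⁿ n satisfies F (p - r) ≡ F r modulo an odd p.  In the proof of Gauss's lemma this absorbs
-- both the signs of the absolutely least residues and the parity argument relating them to floors.
opaque
  F : ℕ → ℤ
  F n = ε n * + n

  F-def : ∀ n → F n ≡ ε n * + n
  F-def n = refl

F-square : ∀ n → F n * F n ≡ + n * + n
F-square n = trans (cong₂ _*_ (F-def n) (F-def n))
  (trans (regroup (ε n) (+ n)) (trans (cong (_* (+ n * + n)) (ε-square n)) (ℤ.*-identityˡ _)))
  where
  regroup : ∀ x y → (x * y) * (x * y) ≡ (x * x) * (y * y)
  regroup = ℤ-ring

ε-odd-* : ∀ {a} k → ε a ≡ -1ℤ → ε (a ℕ.* k) ≡ ε k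
ε-odd-* {a} k odd = trans (ε-* a k) (trans (cong (_^ k) odd) (-1^≡ε k))

-- As `p` is odd, `m` and `r` have opposite parities, while r ≡ -m modulo `p`; the two changes of
-- sign cancel.
F-reflect : ∀ {m r p} → ε p ≡ -1ℤ → m ℕ.+ r ≡ p → F r ≡ F m [mod + p ]
F-reflect {m} {r} {p} odd m+r≡p = ≡mod-by (ε r) eq
  where
  open ≡-Reasoning
  opposite : ε m ≡ - ε r
  opposite = begin
    ε m                   ≡⟨ ℤ.*-identityʳ (ε m) ⟨
    ε m * 1ℤ              ≡⟨ cong (ε m *_) (ε-square r) ⟨
    ε m * (ε r * ε r)     ≡⟨ ℤ.*-assoc (ε m) (ε r) (ε r) ⟨
    ε m * ε r * ε r       ≡⟨ cong (_* ε r) (trans (sym (ε-+ m r)) (trans (cong ε m+r≡p) odd)) ⟩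
    -1ℤ * ε r             ≡⟨ ℤ.-1*i≡-i (ε r) ⟩
    - ε r                 ∎
  expand : ∀ e m r → e * r ≡ - e * m + e * (m + r)
  expand = ℤ-ring
  eq : F r ≡ F m + ε r * + p
  eq = trans (F-def r) (trans (expand (ε r) (+ m) (+ r))
    (cong₂ (λ x y → x + ε r * y) (trans (cong (_* + m) (sym opposite)) (sym (F-def m)))
      (trans (sym (ℤ.pos-+ m r)) (cong +_ m+r≡p))))

prod₁ : (n : ℕ) → (ℕ → ℤ) → ℤ
prod₁ n f = prod {n} (λ i → f (suc (toℕ i)))

∤-prod : ∀ {p n} (f : Fin n → ℤ) → Prime p → (∀ i → ¬ + p ℤ∣.∣ f i) → ¬ + p ℤ∣.∣ prod f
∤-prod {n = zero}  f pp p∤f d with ℕ∣.∣1⇒≡1 (∣⇒∣ᵤ d)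
... | refl = ¬prime[1] pp
∤-prod {n = suc n} f pp p∤f d with euclidsLemma-ℤ pp (f zero) _ d
... | inj₁ d₀ = p∤f zero d₀
... | inj₂ d₊ = ∤-prod (f ∘ suc) pp (p∤f ∘ suc) d₊

<⇒∤ : ∀ {n p} → 0 ℕ.< n → n ℕ.< p → ¬ p ℕ∣.∣ n
<⇒∤ {suc n} 0<n n<p = ℕ∣.>⇒∤ n<p


-- A prime dividing x² - y² divides x - y or x + y, and the latter lies strictly between 0 and `p`.
square-injective-mod : ∀ {p} → Prime p → ∀ k l → suc k ℕ.+ suc l ℕ.< p →
                       + suc k * + suc k ≡ + suc l * + suc l [mod + p ] → k ≡ l
square-injective-mod {p} pp k l k+l<p (mod d) =
  [ (λ d → ℕ.suc-injective (+≡+⇒≡ (ℕ.≤-<-trans (ℕ.m≤m+n (suc k) (suc l)) k+l<p) (ℕ.≤-<-trans (ℕ.m≤n+m (suc l) (suc k)) k+l<p) (mod d)))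
  , (λ d → contradiction (∣⇒∣ᵤ d) (<⇒∤ ℕ.z<s k+l<p)) ]′
  (euclidsLemma-ℤ pp (+ suc k - + suc l) (+ suc k + + suc l) (subst (+ p ℤ∣.∣_) (factor (+ suc k) (+ suc l)) d))
  where
  factor : ∀ x y → x * x - y * y ≡ (x - y) * (x + y)
  factor = ℤ-ring

module _ {p : ℕ} (h : ℕ) .{{_ : NonZero p}} (p≡1+2h : p ≡ suc (2 ℕ.* h)) where

  ε-p : ε p ≡ -1ℤ
  ε-p = trans (cong ε p≡1+2h) (trans (ε-suc (2 ℕ.* h)) (cong (-1ℤ *_) (ε-double h)))

  private
    small<p : ∀ {n} → n ℕ.≤ 2 ℕ.* h → n ℕ.< p
    small<p n≤2h = ℕ.≤-trans (s≤s n≤2h) (ℕ.≤-reflexive (sym p≡1+2h))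

  module _ {a : ℕ} (pp : Prime p) (a-odd : ε a ≡ -1ℤ) (p∤a : ¬ p ℕ∣.∣ a) where

    private
      e : ℕ → ℕ
      e k = (a ℕ.* k) ℕ./ p

      -- As `a` and `p` are odd, k has the parity of ak = r + e p, that is of r + e. So the sign in
      -- F k splits into the sign of the floor and the sign in F r.
      reduce : ∀ k → + a * F k ≡ ε (e k) * F ((a ℕ.* k) ℕ.% p) [mod + p ]
      reduce k = begin
        + a * F k                      ≡⟨ cong (+ a *_) (F-def k) ⟩
        + a * (ε k * + k)              ≡⟨ swap (+ a) (ε k) (+ k) ⟩
        ε k * (+ a * + k)              ≡⟨ cong₂ _*_ ε-k (sym (ℤ.pos-* a k)) ⟩
        (ε (e k) * ε r) * + w          ≈⟨ *-congˡ-mod (ε (e k) * ε r) w≡r ⟩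
        (ε (e k) * ε r) * + r          ≡⟨ ℤ.*-assoc (ε (e k)) (ε r) (+ r) ⟩
        ε (e k) * (ε r * + r)          ≡⟨ cong (ε (e k) *_) (F-def r) ⟨
        ε (e k) * F r                  ∎
        where
        open ≡mod-Reasoning (+ p)
        w = a ℕ.* k
        r = w ℕ.% p
        swap : ∀ a x k → a * (x * k) ≡ x * (a * k)
        swap = ℤ-ring
        w≡r : + w ≡ + r [mod + p ]
        w≡r = ≡mod-by (+ (e k)) (trans (cong +_ (m≡m%n+[m/n]*n w p))
                (trans (ℤ.pos-+ r (e k ℕ.* p)) (cong (λ x → + r + x) (ℤ.pos-* (e k) p))))
        ε-k : ε k ≡ ε (e k) * ε r
        ε-k = trans (sym (ε-odd-* {a} k a-odd)) (trans (cong ε (m≡m%n+[m/n]*n w p))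
                (trans (ε-+ r (e k ℕ.* p)) (trans (ℤ.*-comm (ε r) _)
                  (cong (_* ε r) (trans (cong ε (ℕ.*-comm (e k) p)) (ε-odd-* {p} (e k) ε-p))))))

      -- The remainder r of ak is nonzero and is folded into 1, ..., h: it is kept if r ≤ h and
      -- replaced by p - r otherwise. F agrees at both modulo `p`, so the only sign left is that of
      -- the floor.
      step : ∀ (i : Fin h) → let k = suc (toℕ i) in
             ∃[ j ] + a * F k ≡ ε (e k) * F (suc (toℕ {h} j)) [mod + p ]
      step i = go ((a ℕ.* suc (toℕ i)) ℕ.% p) refl
        where
        k = suc (toℕ i)
        k<p : k ℕ.< p
        k<p = small<p (ℕ.≤-trans (Fin.toℕ<n i) (ℕ.m≤m+n h _))
        go : ∀ r → (a ℕ.* k) ℕ.% p ≡ r → ∃[ j ] + a * F k ≡ ε (e k) * F (suc (toℕ {h} j)) [mod + p ]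
        go zero    r≡ with euclidsLemma a k pp (ℕ∣.m%n≡0⇒n∣m (a ℕ.* k) p r≡)
        ... | inj₁ p∣a = contradiction p∣a p∤a
        ... | inj₂ p∣k = contradiction p∣k (<⇒∤ ℕ.z<s k<p)
        go (suc r) r≡ with suc r ℕ.≤? h
        ... | yes r<h = fromℕ< r<h ,
          subst (λ x → + a * F k ≡ ε (e k) * F x [mod + p ])
            (trans r≡ (cong suc (sym (Fin.toℕ-fromℕ< r<h)))) (reduce k)
        ... | no r≮h = fromℕ< m<h ,
          ≡mod-trans (reduce k) (*-congˡ-mod (ε (e k))
            (subst₂ (λ x y → F x ≡ F y [mod + p ]) (sym r≡) (cong suc (sym (Fin.toℕ-fromℕ< m<h)))
              (F-reflect {suc m} {suc r} ε-p m+r≡p)))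
          where
          r<2h : suc r ℕ.≤ 2 ℕ.* h
          r<2h = ℕ.s≤s⁻¹ (subst₂ ℕ._<_ r≡ p≡1+2h (m%n<n (a ℕ.* k) p))
          m = 2 ℕ.* h ℕ.∸ suc r
          m+r≡p : suc m ℕ.+ suc r ≡ p
          m+r≡p = trans (cong suc (ℕ.m∸n+n≡m r<2h)) (sym p≡1+2h)
          m<h : suc m ℕ.≤ h
          m<h = ℕ.+-cancelʳ-≤ h (suc m) h (ℕ.s≤s⁻¹ (ℕ.≤-trans (ℕ.+-monoʳ-≤ (suc (suc m)) (ℕ.≤-refl {h}))
            (ℕ.≤-trans (ℕ.≤-reflexive (sym (ℕ.+-suc (suc m) h)))
            (ℕ.≤-trans (ℕ.+-monoʳ-≤ (suc m) (ℕ.≰⇒> r≮h))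
            (ℕ.≤-reflexive (trans (cong suc (ℕ.m∸n+n≡m r<2h)) (cong (λ x → suc (h ℕ.+ x)) (ℕ.+-identityʳ h))))))))

      σ : Fin h → Fin h
      σ i = proj₁ (step i)

      p∤+a : ¬ + p ℤ∣.∣ + a
      p∤+a = p∤a ∘ ∣⇒∣ᵤ

      small : (i : Fin h) → suc (toℕ i) ℕ.≤ h
      small = Fin.toℕ<n

      -- Squaring removes all signs; since squares separate 1, ..., h modulo `p`, this makes `σ`
      -- injective.
      square : ∀ i → let k = + suc (toℕ i) ; m = + suc (toℕ (σ i)) in
               (+ a * + a) * (k * k) ≡ m * m [mod + p ]
      square i = begin
        (+ a * + a) * (+ k * + k)                     ≡⟨ cong ((+ a * + a) *_) (F-square k) ⟨
        (+ a * + a) * (F k * F k)                     ≡⟨ regroup (+ a) (F k) ⟩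
        (+ a * F k) * (+ a * F k)                     ≈⟨ *-cong-mod (proj₂ (step i)) (proj₂ (step i)) ⟩
        (ε (e k) * F m) * (ε (e k) * F m)             ≡⟨ regroup (ε (e k)) (F m) ⟨
        (ε (e k) * ε (e k)) * (F m * F m)             ≡⟨ cong₂ _*_ (ε-square (e k)) (F-square m) ⟩
        1ℤ * (+ m * + m)                              ≡⟨ ℤ.*-identityˡ _ ⟩
        + m * + m                                     ∎
        where
        open ≡mod-Reasoning (+ p)
        k = suc (toℕ i)
        m = suc (toℕ (σ i))
        regroup : ∀ x y → (x * x) * (y * y) ≡ (x * y) * (x * y)
        regroup = ℤ-ring

      σ-injective : Injective _≡_ _≡_ σ
      σ-injective {i} {j} σi≡σj = Fin.toℕ-injective (square-injective-mod pp (toℕ i) (toℕ j)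
          (small<p (ℕ.+-mono-≤ (small i) (ℕ.≤-trans (small j) (ℕ.m≤m+n h 0)))) k²≡l²)
        where
        k²≡l² : + suc (toℕ i) * + suc (toℕ i) ≡ + suc (toℕ j) * + suc (toℕ j) [mod + p ]
        k²≡l² = *-cancelˡ-mod pp (+ a * + a) (λ d → [ p∤+a , p∤+a ]′ (euclidsLemma-ℤ pp (+ a) (+ a) d))
          (≡mod-trans (square i) (≡mod-trans (≡mod-reflexive
            (cong (λ x → + suc (toℕ x) * + suc (toℕ x)) σi≡σj)) (≡mod-sym (square j))))

    -- Multiplying `step` over k = 1, ..., h gives the product of all F k on both sides, because `σ`
    -- permutes the indices, and this product is prime to `p`.
    gaussLemma : (+ a) ^ h ≡ prod₁ h (λ k → ε ((a ℕ.* k) ℕ./ p)) [mod + p ]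
    gaussLemma = *-cancelˡ-mod pp (prod₁ h F) p∤prodF (begin
      prod₁ h F * (+ a) ^ h                 ≡⟨ ℤ.*-comm (prod₁ h F) _ ⟩
      (+ a) ^ h * prod₁ h F                 ≡⟨ cong (_* prod₁ h F) (prod-const h (+ a)) ⟨
      prod {h} (λ _ → + a) * prod₁ h F      ≡⟨ prod-distrib-* {h} (λ _ → + a) _ ⟨
      prod₁ h (λ k → + a * F k)             ≈⟨ prod-cong-mod (λ i → proj₂ (step i)) ⟩
      prod (λ i → s i * F (suc (toℕ (σ i)))) ≡⟨ prod-distrib-* s _ ⟩
      prod s * prod (λ i → F (suc (toℕ (σ i)))) ≡⟨ cong (prod s *_) (prod-injective (λ i → F (suc (toℕ i))) σ σ-injective) ⟩
      prod s * prod₁ h F                    ≡⟨ ℤ.*-comm (prod s) _ ⟩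
      prod₁ h F * prod s                    ∎)
      where
      open ≡mod-Reasoning (+ p)
      s : Fin h → ℤ
      s i = ε (e (suc (toℕ i)))
      p∤prodF : ¬ + p ℤ∣.∣ prod₁ h F
      p∤prodF = ∤-prod _ pp λ i d → [ p∤± (suc (toℕ i)) , (λ p∣k → <⇒∤ ℕ.z<s
          (small<p (ℕ.≤-trans (small i) (ℕ.m≤m+n h _))) (∣⇒∣ᵤ p∣k)) ]′ (euclidsLemma-ℤ pp (ε (suc (toℕ i))) _ (subst (+ p ℤ∣.∣_) (F-def (suc (toℕ i))) d))
        where
        p∤± : ∀ n → ¬ + p ℤ∣.∣ ε n
        p∤± n d with ε n | ε≡±1 n
        ... | _ | inj₁ refl = ¬prime[1] (subst Prime (ℕ∣.∣1⇒≡1 (∣⇒∣ᵤ d)) pp)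
        ... | _ | inj₂ refl = ¬prime[1] (subst Prime (ℕ∣.∣1⇒≡1 (∣⇒∣ᵤ d)) pp)

-- Signs modulo p, Fermat's theorem and the character of 2.

IsSign : ℤ → Set
IsSign s = s ≡ 1ℤ ⊎ s ≡ -1ℤ

IsSign-* : ∀ {s t} → IsSign s → IsSign t → IsSign (s * t)
IsSign-* (inj₁ refl) (inj₁ refl) = inj₁ refl
IsSign-* (inj₁ refl) (inj₂ refl) = inj₂ refl
IsSign-* (inj₂ refl) (inj₁ refl) = inj₂ refl
IsSign-* (inj₂ refl) (inj₂ refl) = inj₁ refl

IsSign-prod : ∀ {n} (f : Fin n → ℤ) → (∀ i → IsSign (f i)) → IsSign (prod f)
IsSign-prod {zero}  f f± = inj₁ refl
IsSign-prod {suc n} f f± = IsSign-* (f± zero) (IsSign-prod (f ∘ suc) (f± ∘ suc))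

IsSign-square : ∀ {s} → IsSign s → s * s ≡ 1ℤ
IsSign-square (inj₁ refl) = refl
IsSign-square (inj₂ refl) = refl

IsSign-product≡1 : ∀ {s t} → IsSign s → IsSign t → s * t ≡ 1ℤ → s ≡ t
IsSign-product≡1 (inj₁ refl) (inj₁ refl) _ = refl
IsSign-product≡1 (inj₁ refl) (inj₂ refl) ()
IsSign-product≡1 (inj₂ refl) (inj₁ refl) ()
IsSign-product≡1 (inj₂ refl) (inj₂ refl) _ = refl

oddPrime>2 : ∀ {p} h → Prime p → p ≡ suc (2 ℕ.* h) → 2 ℕ.< p
oddPrime>2 zero    pp refl = contradiction pp ¬prime[1]
oddPrime>2 (suc h) pp refl = s≤s (subst (2 ℕ.≤_) (sym (ℕ.*-suc 2 h)) (ℕ.m≤m+n 2 _))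

1≢-1-mod : ∀ {p} → 2 ℕ.< p → ¬ 1ℤ ≡ -1ℤ [mod + p ]
1≢-1-mod 2<p (mod d) = <⇒∤ ℕ.z<s 2<p (∣⇒∣ᵤ d)

IsSign-mod⇒≡ : ∀ {p s t} → 2 ℕ.< p → IsSign s → IsSign t → s ≡ t [mod + p ] → s ≡ t
IsSign-mod⇒≡ 2<p (inj₁ refl) (inj₁ refl) _   = refl
IsSign-mod⇒≡ 2<p (inj₂ refl) (inj₂ refl) _   = refl
IsSign-mod⇒≡ 2<p (inj₁ refl) (inj₂ refl) s≡t = contradiction s≡t (1≢-1-mod 2<p)
IsSign-mod⇒≡ 2<p (inj₂ refl) (inj₁ refl) s≡t = contradiction (≡mod-sym s≡t) (1≢-1-mod 2<p)

module _ {p : ℕ} (h : ℕ) .{{_ : NonZero p}} (p≡1+2h : p ≡ suc (2 ℕ.* h)) (pp : Prime p) where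

  private
    shift : ∀ a → + (a ℕ.+ p) ≡ + a [mod + p ]
    shift a = ≡mod-by 1ℤ (trans (ℤ.pos-+ a p) (cong (λ x → + a + x) (sym (ℤ.*-identityˡ (+ p)))))

    -- Gauss's lemma above wants an odd base; for even `a` the base a + p is odd and congruent to
    -- it.
    shifted-gaussLemma : ∀ {a} → ε a ≡ 1ℤ → ¬ p ℕ∣.∣ a →
                         (+ a) ^ h ≡ prod₁ h (λ k → ε (((a ℕ.+ p) ℕ.* k) ℕ./ p)) [mod + p ]
    shifted-gaussLemma {a} even p∤a = ≡mod-trans (^-cong-mod h (≡mod-sym (shift a)))
      (gaussLemma h p≡1+2h pp (trans (ε-+ a p) (trans (cong (_* ε p) even) (trans (ℤ.*-identityˡ (ε p)) (ε-p h p≡1+2h))))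
        (λ d → p∤a (ℕ∣.∣m+n∣m⇒∣n (subst (p ℕ∣.∣_) (ℕ.+-comm a p) d) ℕ∣.∣-refl)))

  opaque
    halfPower : ∀ {a} → ¬ p ℕ∣.∣ a → ∃[ s ] IsSign s × (+ a) ^ h ≡ s [mod + p ]
    halfPower {a} p∤a = [ (λ even → _ , IsSign-prod {h} _ (λ i → ε≡±1 (((a ℕ.+ p) ℕ.* suc (toℕ i)) ℕ./ p)) , shifted-gaussLemma even p∤a)
                        , (λ odd → _ , IsSign-prod {h} _ (λ i → ε≡±1 ((a ℕ.* suc (toℕ i)) ℕ./ p)) , gaussLemma h p≡1+2h pp odd p∤a) ]′ (ε≡±1 a)

  -- Obtained by squaring a^h ≡ ±1, which Gauss's lemma already supplies.
  fermat : ∀ {a} → ¬ p ℕ∣.∣ a → (+ a) ^ (2 ℕ.* h) ≡ 1ℤ [mod + p ]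
  fermat {a} p∤a with s , s± , a^h≡s ← halfPower p∤a = begin
    (+ a) ^ (2 ℕ.* h)            ≡⟨ cong (λ x → (+ a) ^ (h ℕ.+ x)) (ℕ.+-identityʳ h) ⟩
    (+ a) ^ (h ℕ.+ h)            ≡⟨ ℤ.^-distribˡ-+-* (+ a) h h ⟩
    (+ a) ^ h * (+ a) ^ h        ≈⟨ *-cong-mod a^h≡s a^h≡s ⟩
    s * s                        ≡⟨ IsSign-square s± ⟩
    1ℤ                           ∎
    where open ≡mod-Reasoning (+ p)

  -- For the odd base 2 + p the floor at k is k itself, since 2k < p. The product of (-1)^k over k =
  -- 1, ..., 2t falls into t pairs, each contributing -1.
  twoPower : ∀ t → h ≡ 2 ℕ.* t → (+ 2) ^ h ≡ ε t [mod + p ]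
  twoPower t h≡2t = begin
    (+ 2) ^ h                                     ≈⟨ shifted-gaussLemma (ε-double 1) (<⇒∤ ℕ.z<s (oddPrime>2 h pp p≡1+2h)) ⟩
    prod₁ h (λ k → ε (((2 ℕ.+ p) ℕ.* k) ℕ./ p))   ≡⟨ prod-cong (λ i → cong ε (quotient i)) ⟩
    prod₁ h ε                                     ≡⟨ cong (λ n → prod₁ n ε) h≡2t ⟩
    prod₁ (2 ℕ.* t) ε                             ≡⟨ prod₁-ε t ⟩
    ε t                                           ∎
    where
    open ≡mod-Reasoning (+ p)
    quotient : ∀ (i : Fin h) → ((2 ℕ.+ p) ℕ.* suc (toℕ i)) ℕ./ p ≡ suc (toℕ i)
    quotient i = trans (cong (ℕ._/ p) (ℕ.*-distribʳ-+ k 2 p))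
      (trans (+-distrib-/-∣ʳ (2 ℕ.* k) (ℕ∣.m∣m*n k))
      (cong₂ ℕ._+_ (m<n⇒m/n≡0 2k<p) (trans (cong (ℕ._/ p) (ℕ.*-comm p k)) (m*n/n≡m k p))))
      where
      k = suc (toℕ i)
      2k<p : 2 ℕ.* k ℕ.< p
      2k<p = ℕ.≤-trans (s≤s (ℕ.*-monoʳ-≤ 2 (Fin.toℕ<n i))) (ℕ.≤-reflexive (sym p≡1+2h))
    ε-2+ : ∀ n → ε (suc (suc n)) ≡ ε n
    ε-2+ n = trans (ε-+ 2 n) (trans (cong (_* ε n) (ε-double 1)) (ℤ.*-identityˡ (ε n)))
    prod₁-ε : ∀ t → prod₁ (2 ℕ.* t) ε ≡ ε t
    prod₁-ε zero    = sym ε-0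
    prod₁-ε (suc t) = trans (cong (λ n → prod₁ n ε) (ℕ.*-suc 2 t))
      (trans (sym (ℤ.*-assoc (ε 1) (ε 2) _))
      (trans (cong₂ _*_ ε1*ε2 (trans (prod-cong {n = 2 ℕ.* t} (λ i → ε-2+ (suc (toℕ i)))) (prod₁-ε t))) (sym (ε-suc t))))
      where
      ε1*ε2 : ε 1 * ε 2 ≡ -1ℤ
      ε1*ε2 = cong₂ _*_ (trans (ε-suc 0) (cong (-1ℤ *_) ε-0)) (ε-double 1)

-- Quadratic reciprocity.

≤/⇒*≤ : ∀ {n m p} .{{_ : NonZero p}} → n ℕ.≤ m ℕ./ p → n ℕ.* p ℕ.≤ m
≤/⇒*≤ {n} {m} {p} n≤m/p = ℕ.≤-trans (ℕ.*-monoˡ-≤ p n≤m/p) (m/n*n≤m m p)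

*≤⇒≤/ : ∀ {n m p} .{{_ : NonZero p}} → n ℕ.* p ℕ.≤ m → n ℕ.≤ m ℕ./ p
*≤⇒≤/ {n} {m} {p} np≤m = subst (ℕ._≤ m ℕ./ p) (m*n/n≡m n p) (/-monoˡ-≤ p np≤m)

-- Written as products of the signs δ, the two floor sums of Eisenstein's proof become double products over
-- the lattice points above and below the diagonal.
δ : ℕ → ℕ → ℤ
δ zero    i       = 1ℤ
δ (suc e) zero    = -1ℤ
δ (suc e) (suc i) = δ e i

ε≡prod-δ : ∀ {e} j → e ℕ.≤ j → ε e ≡ prod {j} (λ i → δ e (toℕ i))
ε≡prod-δ {zero} j _ = trans ε-0 (sym (trans (prod-const j 1ℤ) (ℤ.^-zeroˡ j)))
ε≡prod-δ {suc e} (suc j) (s≤s e≤j) = trans (ε-suc e) (cong (-1ℤ *_) (ε≡prod-δ j e≤j))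

δ-< : ∀ {e i} → i ℕ.< e → δ e i ≡ -1ℤ
δ-< {suc e} {zero}  _         = refl
δ-< {suc e} {suc i} (s≤s i<e) = δ-< i<e

δ-≥ : ∀ {e i} → e ℕ.≤ i → δ e i ≡ 1ℤ
δ-≥ z≤n       = refl
δ-≥ (s≤s e≤i) = δ-≥ e≤i

prime∣prime⇒≡ : ∀ {p l} → Prime p → Prime l → p ℕ∣.∣ l → p ≡ l
prime∣prime⇒≡ pp pl p∣l with prime⇒irreducible pl p∣l
... | inj₁ refl = contradiction pp ¬prime[1]
... | inj₂ p≡l  = p≡l

module _ {p l : ℕ} (h j : ℕ) .{{_ : NonZero p}} .{{_ : NonZero l}}
         (p≡1+2h : p ≡ suc (2 ℕ.* h)) (l≡1+2j : l ≡ suc (2 ℕ.* j))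
         (pp : Prime p) (pl : Prime l) (p≢l : p ≢ l) where

  private
    -- Ensures that the h by j rectangle contains every lattice point counted by the floors: (j + 1)
    -- p exceeds l h by j + h + 1.
    floor-bound : ∀ {p l} h j .{{_ : NonZero p}} → p ≡ suc (2 ℕ.* h) → l ≡ suc (2 ℕ.* j) →
                  (i : Fin h) → (l ℕ.* suc (toℕ i)) ℕ./ p ℕ.≤ j
    floor-bound {p} {l} h j refl refl i = ℕ.s≤s⁻¹ (m<n*o⇒m/o<n (ℕ.≤-<-trans (ℕ.*-monoʳ-≤ l (Fin.toℕ<n i))
      (subst (l ℕ.* h ℕ.<_) (sym (expand h j)) (s≤s (ℕ.m≤m+n (l ℕ.* h) (j ℕ.+ h))))))
      where
      expand : ∀ h j → suc j ℕ.* suc (2 ℕ.* h) ≡ suc (suc (2 ℕ.* j) ℕ.* h ℕ.+ (j ℕ.+ h))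
      expand = ℕ-ring

    e : ℕ → ℕ
    e k = (l ℕ.* k) ℕ./ p
    e′ : ℕ → ℕ
    e′ i = (p ℕ.* i) ℕ./ l

    -- The point (k + 1, i + 1) is off the diagonal, since `l` divides neither i + 1 nor `p`. It is
    -- therefore counted by exactly one of the two floors.
    opposite : (k : Fin h) (i : Fin j) → δ (e (suc (toℕ k))) (toℕ i) * δ (e′ (suc (toℕ i))) (toℕ k) ≡ -1ℤ
    opposite k i = [ below , above ]′ (ℕ.≤-total (suc b ℕ.* p) (l ℕ.* suc a))
      where
      a = toℕ k
      b = toℕ i
      b<l : suc b ℕ.< l
      b<l = ℕ.≤-trans (s≤s (ℕ.≤-trans (Fin.toℕ<n i) (ℕ.m≤m+n j _))) (ℕ.≤-reflexive (sym l≡1+2j))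
      off-diagonal : suc b ℕ.* p ≢ l ℕ.* suc a
      off-diagonal eq with euclidsLemma (suc b) p pl (subst (l ℕ∣.∣_) (sym eq) (ℕ∣.m∣m*n (suc a)))
      ... | inj₁ l∣b = <⇒∤ ℕ.z<s b<l l∣b
      ... | inj₂ l∣p = p≢l (sym (prime∣prime⇒≡ pl pp l∣p))
      below : suc b ℕ.* p ℕ.≤ l ℕ.* suc a → _
      below le = cong₂ _*_ (δ-< (*≤⇒≤/ {n = suc b} {m = l ℕ.* suc a} {p = p} le)) (δ-≥ (ℕ.≮⇒≥ λ lt → off-diagonal (ℕ.≤-antisym le
        (subst₂ ℕ._≤_ (ℕ.*-comm (suc a) l) (ℕ.*-comm p (suc b)) (≤/⇒*≤ {n = suc a} {p = l} lt)))))
      above : l ℕ.* suc a ℕ.≤ suc b ℕ.* p → _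
      above le = cong₂ _*_ (δ-≥ (ℕ.≮⇒≥ λ lt → off-diagonal (ℕ.≤-antisym (≤/⇒*≤ {n = suc b} {m = l ℕ.* suc a} lt) le)))
        (δ-< (*≤⇒≤/ {n = suc a} {p = l} (subst₂ ℕ._≤_ (ℕ.*-comm l (suc a)) (ℕ.*-comm (suc b) p) le)))

  eisenstein : prod₁ h (λ k → ε (e k)) * prod₁ j (λ i → ε (e′ i)) ≡ (-1ℤ ^ j) ^ h
  eisenstein = begin
    prod₁ h (λ k → ε (e k)) * prod₁ j (λ i → ε (e′ i))
      ≡⟨ cong₂ _*_ (prod-cong {n = h} λ k → ε≡prod-δ j (floor-bound h j p≡1+2h l≡1+2j k))
                   (trans (prod-cong {n = j} λ i → ε≡prod-δ h (floor-bound j h l≡1+2j p≡1+2h i)) (prod-comm {j} {h} (λ i k → δ (e′ (suc (toℕ i))) (toℕ k)))) ⟩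
    prod {h} (λ k → prod {j} (λ i → δ (e (suc (toℕ k))) (toℕ i))) * prod {h} (λ k → prod {j} (λ i → δ (e′ (suc (toℕ i))) (toℕ k)))
      ≡⟨ prod-distrib-* {h} _ _ ⟨
    prod {h} (λ k → prod {j} (λ i → δ (e (suc (toℕ k))) (toℕ i)) * prod {j} (λ i → δ (e′ (suc (toℕ i))) (toℕ k)))
      ≡⟨ prod-cong (λ k → trans (sym (prod-distrib-* {j} _ _)) (trans (prod-cong (opposite k)) (prod-const j -1ℤ))) ⟩
    prod {h} (λ _ → -1ℤ ^ j)
      ≡⟨ prod-const h _ ⟩
    (-1ℤ ^ j) ^ h ∎
    where open ≡-Reasoning

  opaque
    -- As h is even, the product of the two signs over the h j lattice points is 1, so the signs
    -- coincide.
    reciprocity : ∀ {t} → h ≡ 2 ℕ.* t → ∃[ s ] IsSign s × (+ l) ^ h ≡ s [mod + p ] × (+ p) ^ j ≡ s [mod + l ]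
    reciprocity {t} h≡2t = prod₁ h (λ k → ε (e k)) , sign , gaussLemma h p≡1+2h pp (ε-p j l≡1+2j) (p≢l ∘ prime∣prime⇒≡ pp pl) ,
      subst ((+ p) ^ j ≡_[mod + l ]) (sym (IsSign-product≡1 sign sign′ (trans eisenstein even)))
        (gaussLemma j l≡1+2j pl (ε-p h p≡1+2h) (p≢l ∘ sym ∘ prime∣prime⇒≡ pl pp))
      where
      sign : IsSign (prod₁ h (λ k → ε (e k)))
      sign = IsSign-prod {h} _ (λ k → ε≡±1 (e (suc (toℕ {h} k))))
      sign′ : IsSign (prod₁ j (λ i → ε (e′ i)))
      sign′ = IsSign-prod {j} _ (λ i → ε≡±1 (e′ (suc (toℕ {j} i))))
      even : (-1ℤ ^ j) ^ h ≡ 1ℤ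
      even = trans (ℤ.^-*-assoc -1ℤ j h) (trans (cong (-1ℤ ^_) (trans (cong (j ℕ.*_) h≡2t) (ℕ.*-comm j (2 ℕ.* t))))
        (trans (sym (ℤ.^-*-assoc -1ℤ (2 ℕ.* t) j)) (trans (cong (_^ j) (trans (-1^≡ε (2 ℕ.* t)) (ε-double t))) (ℤ.^-zeroˡ j))))

-- Roots of polynomials modulo p and existence of a nonresidue.

-- The monic polynomial of degree n whose lower coefficients are a₀ ∷ … ∷ aₙ₋₁ ∷ [].
monic : List ℤ → ℤ → ℤ
monic []       x = 1ℤ
monic (a ∷ as) x = a + x * monic as x

-- quotient r as divides monic (a ∷ as) - monic (a ∷ as) r by X - r, whatever the constant term a.
quotient : ℤ → List ℤ → List ℤ
quotient r []       = []
quotient r (a ∷ as) = monic (a ∷ as) r ∷ quotient r as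

length-quotient : ∀ r as → length (quotient r as) ≡ length as
length-quotient r []       = refl
length-quotient r (a ∷ as) = cong suc (length-quotient r as)

quotient-factor : ∀ r a as x → monic (a ∷ as) x - monic (a ∷ as) r ≡ (x - r) * monic (quotient r as) x
quotient-factor r a []       x = linear a x r
  where
  linear : ∀ a x r → (a + x * 1ℤ) - (a + r * 1ℤ) ≡ (x - r) * 1ℤ
  linear = ℤ-ring
quotient-factor r a (b ∷ bs) x = trans (split a x r (monic (b ∷ bs) x) (monic (b ∷ bs) r))
  (trans (cong (λ y → x * y + (x - r) * monic (b ∷ bs) r) (quotient-factor r b bs x))
    (collect x (x - r) (monic (quotient r bs) x) (monic (b ∷ bs) r)))
  where
  split : ∀ a x r ex er → (a + x * ex) - (a + r * er) ≡ x * (ex - er) + (x - r) * er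
  split = ℤ-ring
  collect : ∀ x d q er → x * (d * q) + d * er ≡ d * (er + x * q)
  collect = ℤ-ring

-- Dividing by X - r for the largest root r leaves a monic polynomial of lower degree. It vanishes
-- at the other roots, which differ from r modulo `p` because all of them lie below `p`.
lagrange : ∀ {p} → Prime p → ∀ n as → length as ≡ n → suc n ℕ.< p →
           ¬ (∀ k → k ℕ.≤ n → monic as (+ suc k) ≡ 0ℤ [mod + p ])
lagrange pp zero []        refl 1<p root = <⇒∤ ℕ.z<s 1<p (∣⇒∣ᵤ (≡0⇒∣ (root 0 z≤n)))
lagrange {p} pp (suc n) (a ∷ as) eq   2+n<p root =
  lagrange pp n (quotient r as) (trans (length-quotient r as) (ℕ.suc-injective eq)) (ℕ.<-trans (ℕ.n<1+n _) 2+n<p) root′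
  where
  r : ℤ
  r = + suc (suc n)
  root′ : ∀ k → k ℕ.≤ n → monic (quotient r as) (+ suc k) ≡ 0ℤ [mod + p ]
  root′ k k≤n = [ (λ d → contradiction (ℕ.suc-injective (+≡+⇒≡ (ℕ.<-trans (s≤s (s≤s k≤n)) 2+n<p) 2+n<p (mod d)))
                           (ℕ.<⇒≢ (s≤s k≤n)))
                , ∣⇒≡0 ]′ (euclidsLemma-ℤ pp (+ suc k - r) (monic (quotient r as) (+ suc k))
    (subst (+ p ℤ∣.∣_) (quotient-factor r a as (+ suc k))
      (diff (≡mod-trans (root k (ℕ.m≤n⇒m≤1+n k≤n)) (≡mod-sym (root (suc n) ℕ.≤-refl))))))

monic-replicate : ∀ n x → monic (replicate n 0ℤ) x ≡ x ^ n
monic-replicate zero    x = refl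
monic-replicate (suc n) x = trans (ℤ.+-identityˡ _) (cong (x *_) (monic-replicate n x))

opaque
  -- X^h - 1 cannot vanish at all of 1, ..., h + 1, and a power u^h that is not 1 is -1.
  nonresidue : ∀ {p} h → p ≡ suc (2 ℕ.* h) → Prime p → ∃[ u ] (+ u) ^ h ≡ -1ℤ [mod + p ]
  nonresidue         zero      refl pp = contradiction pp ¬prime[1]
  nonresidue {p} h@(suc n) p≡1+2h pp = suc (toℕ i) , subst ((+ suc (toℕ i)) ^ h ≡_[mod + p ]) s≡-1 u^h≡s
    where
    instance
      p≢0 : NonZero p
      p≢0 = prime⇒nonZero pp
    h<p : suc h ℕ.< p
    h<p = ℕ.≤-trans (s≤s (s≤s (ℕ.≤-trans (ℕ.m≤n+m (suc n) n) (ℕ.+-monoʳ-≤ n (ℕ.m≤m+n (suc n) 0)))))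
      (ℕ.≤-reflexive (sym p≡1+2h))
    power : ℕ → ℤ
    power k = (+ suc k) ^ h
    ¬all : ¬ ((i : Fin (suc h)) → + p ℤ∣.∣ power (toℕ i) - 1ℤ)
    -- The list holds the lower coefficients of X^h - 1.
    ¬all all = lagrange pp h (-1ℤ ∷ replicate n 0ℤ) (cong suc (length-replicate n)) h<p λ k k≤h →
      ∣⇒≡0 (subst (+ p ℤ∣.∣_) (trans (ℤ.+-comm (power k) -1ℤ)
          (cong (λ y → -1ℤ + + suc k * y) (sym (monic-replicate n (+ suc k)))))
        (subst (λ j → + p ℤ∣.∣ power j - 1ℤ) (Fin.toℕ-fromℕ< (s≤s k≤h)) (all (fromℕ< (s≤s k≤h)))))
    ∃i : ∃[ i ] ¬ + p ℤ∣.∣ power (toℕ {suc h} i) - 1ℤ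
    ∃i = Fin.¬∀⟶∃¬ (suc h) (λ i → + p ℤ∣.∣ power (toℕ i) - 1ℤ) (λ i → ℤ∣._∣?_ (+ p) (power (toℕ i) - 1ℤ)) ¬all
    i : Fin (suc h)
    i = proj₁ ∃i
    hp : ∃[ s ] IsSign s × power (toℕ i) ≡ s [mod + p ]
    hp = halfPower h p≡1+2h pp (<⇒∤ ℕ.z<s (ℕ.≤-<-trans (Fin.toℕ<n i) h<p))
    u^h≡s : power (toℕ i) ≡ proj₁ hp [mod + p ]
    u^h≡s = proj₂ (proj₂ hp)
    s≡-1 : proj₁ hp ≡ -1ℤ
    s≡-1 = [ (λ s≡1 → contradiction (diff (subst (power (toℕ i) ≡_[mod + p ]) s≡1 u^h≡s)) (proj₂ ∃i)) , id ]′ (proj₁ (proj₂ hp))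

-- Computing Legendre symbols.

prime[3] : Prime 3
prime[3] = from-yes (prime? 3)

^-distribʳ-* : ∀ x y n → (x * y) ^ n ≡ x ^ n * y ^ n
^-distribʳ-* x y zero    = refl
^-distribʳ-* x y (suc n) = trans (cong (x * y *_) (^-distribʳ-* x y n)) (interchange x y (x ^ n) (y ^ n))
  where
  interchange : ∀ a b c d → (a * b) * (c * d) ≡ (a * c) * (b * d)
  interchange = ℤ-ring

even-or-odd : ∀ n → ∃[ j ] (n ≡ 2 ℕ.* j ⊎ n ≡ suc (2 ℕ.* j))
even-or-odd zero = 0 , inj₁ refl
even-or-odd (suc n) with even-or-odd n
... | j , inj₁ refl = j , inj₂ refl
... | j , inj₂ refl = suc j , inj₁ (sym (ℕ.*-suc 2 j))

oddPrime : ∀ {p} → Prime p → p ≢ 2 → ∃[ h ] p ≡ suc (2 ℕ.* h)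
oddPrime {p} pp p≢2 with even-or-odd p
... | h , inj₁ p≡2h = contradiction (sym (prime∣prime⇒≡ prime[2] pp (ℕ∣.divides h (trans p≡2h (ℕ.*-comm 2 h))))) p≢2
... | h , inj₂ p≡1+2h = h , p≡1+2h

IsSign-even-power : ∀ {s} t → IsSign s → s ^ (2 ℕ.* t) ≡ 1ℤ
IsSign-even-power {s} t s± = trans (sym (ℤ.^-*-assoc s 2 t)) (trans (cong (_^ t) (square s±)) (ℤ.^-zeroˡ t))
  where
  square : ∀ {s} → IsSign s → s ^ 2 ≡ 1ℤ
  square (inj₁ refl) = refl
  square (inj₂ refl) = refl

signPart : ∀ g → ∃[ s ] IsSign s × g ≡ s * + ∣ g ∣
signPart (+ n)    = 1ℤ , inj₁ refl , sym (ℤ.*-identityˡ (+ n))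
signPart -[1+ n ] = -1ℤ , inj₂ refl , sym (ℤ.-1*i≡-i (+ suc n))

module _ {p : ℕ} (h : ℕ) (p≡1+2h : p ≡ suc (2 ℕ.* h)) (pp : Prime p) where

  private instance
    p≢0 : NonZero p
    p≢0 = prime⇒nonZero pp

  square-times-power : ∀ c d s → ¬ p ℕ∣.∣ s → (c * + (d ℕ.* (s ℕ.* s))) ^ h ≡ c ^ h * (+ d) ^ h [mod + p ]
  square-times-power c d s p∤s = begin
    (c * + (d ℕ.* (s ℕ.* s))) ^ h             ≡⟨ cong (λ x → (c * x) ^ h) (trans (ℤ.pos-* d (s ℕ.* s)) (cong (+ d *_) (ℤ.pos-* s s))) ⟩
    (c * (+ d * (+ s * + s))) ^ h             ≡⟨ cong (_^ h) (ℤ.*-assoc c (+ d) (+ s * + s)) ⟨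
    (c * + d * (+ s * + s)) ^ h               ≡⟨ ^-distribʳ-* (c * + d) (+ s * + s) h ⟩
    (c * + d) ^ h * (+ s * + s) ^ h           ≡⟨ cong ((c * + d) ^ h *_) s²^h ⟩
    (c * + d) ^ h * (+ s) ^ (2 ℕ.* h)         ≈⟨ *-congˡ-mod ((c * + d) ^ h) (fermat h p≡1+2h pp p∤s) ⟩
    (c * + d) ^ h * 1ℤ                        ≡⟨ ℤ.*-identityʳ _ ⟩
    (c * + d) ^ h                             ≡⟨ ^-distribʳ-* c (+ d) h ⟩
    c ^ h * (+ d) ^ h                         ∎
    where
    open ≡mod-Reasoning (+ p)
    s²^h : (+ s * + s) ^ h ≡ (+ s) ^ (2 ℕ.* h)
    s²^h = trans (cong (λ x → (+ s * x) ^ h) (sym (ℤ.*-identityʳ (+ s)))) (ℤ.^-*-assoc (+ s) 2 h)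

  product-residue : ∀ n .{{_ : NonZero n}} → (∀ {l} → Prime l → l ℕ∣.∣ n → (+ l) ^ h ≡ 1ℤ [mod + p ]) →
                    (+ n) ^ h ≡ 1ℤ [mod + p ]
  product-residue n residue = subst (λ x → (+ x) ^ h ≡ 1ℤ [mod + p ]) (sym isFactorisation)
      (go factors factorsPrime (λ l∣Π → subst (_ ℕ∣.∣_) (sym isFactorisation) l∣Π))
    where
    open PrimeFactorisation (factorise n)
    go : ∀ ls → All Prime ls → (∀ {l} → l ℕ∣.∣ product ls → l ℕ∣.∣ n) → (+ product ls) ^ h ≡ 1ℤ [mod + p ]
    go []       []         _ = ≡mod-reflexive (ℤ.^-zeroˡ h)
    go (l ∷ ls) (pl ∷ pls) d = ≡mod-trans
      (≡mod-reflexive (trans (cong (_^ h) (ℤ.pos-* l (product ls))) (^-distribʳ-* (+ l) (+ product ls) h)))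
      (*-cong-mod {b = 1ℤ} {d = 1ℤ} (residue pl (d (ℕ∣.m∣m*n (product ls)))) (go ls pls (λ x → d (ℕ∣.∣n⇒∣m*n l x))))

  -- Reciprocity provides some sign common to both symbols. It is congruent to `s` modulo `l` > 2,
  -- hence equal to `s`, and so can be used modulo `p`.
  legendre-flip : ∀ {l j t s} → l ≡ suc (2 ℕ.* j) → Prime l → p ≢ l → h ≡ 2 ℕ.* t → IsSign s →
                  (+ p) ^ j ≡ s [mod + l ] → (+ l) ^ h ≡ s [mod + p ]
  legendre-flip {l} {j} {t} {s} l≡1+2j pl p≢l h≡2t s± p^j≡s =
    let s′ , s′± , l^h≡s′ , p^j≡s′ = reciprocity h j {{p≢0}} {{prime⇒nonZero pl}} p≡1+2h l≡1+2j pp pl p≢l {t} h≡2t in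
    subst ((+ l) ^ h ≡_[mod + p ])
      (IsSign-mod⇒≡ (oddPrime>2 j pl l≡1+2j) s′± s± (≡mod-trans (≡mod-sym p^j≡s′) p^j≡s)) l^h≡s′

  -- 9^j = 3^(2j) is 1 modulo `l` by Fermat, as `l` is not 3.
  residue-of-9 : ∀ {l t} → Prime l → l ≢ 2 → l ≢ 3 → p ≢ l → h ≡ 2 ℕ.* t → + p ≡ + 9 [mod + l ] →
                 (+ l) ^ h ≡ 1ℤ [mod + p ]
  residue-of-9 {l} {t} pl l≢2 l≢3 p≢l h≡2t p≡9 = let j , l≡1+2j = oddPrime pl l≢2 in
    legendre-flip {l} {j} {t} l≡1+2j pl p≢l h≡2t (inj₁ refl)
      (≡mod-trans (^-cong-mod j p≡9) (≡mod-trans (≡mod-reflexive (ℤ.^-*-assoc (+ 3) 2 j))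
        (fermat j {{prime⇒nonZero pl}} l≡1+2j pl (λ l∣3 → l≢3 (prime∣prime⇒≡ pl prime[3] l∣3)))))

-- Orders modulo p and primitive roots.

module _ {m : ℤ} {g : ℤ} where

  power-of-one : ∀ {k} x → g ^ k ≡ 1ℤ [mod m ] → g ^ (x ℕ.* k) ≡ 1ℤ [mod m ]
  power-of-one {k} x g^k≡1 = ≡mod-trans (≡mod-reflexive (trans (cong (g ^_) (ℕ.*-comm x k)) (sym (ℤ.^-*-assoc g k x))))
    (≡mod-trans (^-cong-mod x g^k≡1) (≡mod-reflexive (ℤ.^-zeroˡ x)))

  -- The Bézout identity d + y n = x k over the natural numbers avoids negative exponents, hence
  -- inverses of `g`.
  power-gcd : ∀ {k n} → g ^ k ≡ 1ℤ [mod m ] → g ^ n ≡ 1ℤ [mod m ] → g ^ gcd k n ≡ 1ℤ [mod m ]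
  power-gcd {k} {n} g^k≡1 g^n≡1 = from-identity (Bézout.identity (gcd-GCD k n))
    where
    combined : ∀ {d k n} x y → d ℕ.+ y ℕ.* n ≡ x ℕ.* k → g ^ k ≡ 1ℤ [mod m ] → g ^ n ≡ 1ℤ [mod m ] → g ^ d ≡ 1ℤ [mod m ]
    combined {d} {k} {n} x y eq g^k≡1 g^n≡1 = begin
      g ^ d                      ≡⟨ ℤ.*-identityʳ _ ⟨
      g ^ d * 1ℤ                 ≈⟨ *-congˡ-mod (g ^ d) (power-of-one y g^n≡1) ⟨
      g ^ d * g ^ (y ℕ.* n)      ≡⟨ ℤ.^-distribˡ-+-* g d (y ℕ.* n) ⟨
      g ^ (d ℕ.+ y ℕ.* n)        ≡⟨ cong (g ^_) eq ⟩
      g ^ (x ℕ.* k)              ≈⟨ power-of-one x g^k≡1 ⟩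
      1ℤ                         ∎
      where open ≡mod-Reasoning m
    from-identity : ∀ {d} → Bézout.Identity d k n → g ^ d ≡ 1ℤ [mod m ]
    from-identity (Bézout.+- x y eq) = combined x y eq g^k≡1 g^n≡1
    from-identity (Bézout.-+ x y eq) = combined y x eq g^n≡1 g^k≡1

odd-divisor-2^ : ∀ {e} n → e ℕ∣.∣ 2 ℕ.^ n → ¬ 2 ℕ∣.∣ e → e ≡ 1
odd-divisor-2^ zero    e∣1 2∤e = ℕ∣.∣1⇒≡1 e∣1
odd-divisor-2^ (suc n) e∣2^ 2∤e = odd-divisor-2^ n (Coprime.coprime-divisor coprime e∣2^) 2∤e
  where
  coprime : Coprime.Coprime _ 2
  coprime (d∣e , d∣2) with irreducible[2] d∣2
  ... | inj₁ d≡1  = d≡1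
  ... | inj₂ refl = contradiction d∣e 2∤e

-- The cofactor of `c` is even: an odd divisor of a power of 2 is 1, which would make `c` the whole
-- power.
proper-divisor-2^ : ∀ {c} n → c ℕ∣.∣ 2 ℕ.^ suc n → c ≢ 2 ℕ.^ suc n → c ℕ∣.∣ 2 ℕ.^ n
proper-divisor-2^ {c} n (ℕ∣.divides e 2^≡e*c) c≢ with 2 ℕ∣.∣? e
... | yes (ℕ∣.divides f refl) = ℕ∣.divides f (ℕ.*-cancelˡ-≡ _ _ 2 (trans 2^≡e*c
        (trans (cong (ℕ._* c) (ℕ.*-comm f 2)) (ℕ.*-assoc 2 f c))))
... | no 2∤e = contradiction (sym (trans 2^≡e*c (trans (cong (ℕ._* c)
        (odd-divisor-2^ (suc n) (ℕ∣.divides c (trans 2^≡e*c (ℕ.*-comm e c))) 2∤e)) (ℕ.*-identityˡ c)))) c≢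

-- Modulo p the order of g divides 2ᵃ⁺¹q but not 2ᵃq, so it is a multiple of 2ᵃ⁺¹: either 2ᵃ⁺¹ or 2ᵃ⁺¹q.
primitiveRoot : ∀ {p q g} a → Prime p → Prime q → p ≡ suc (2 ℕ.^ suc a ℕ.* q) → 2 ℕ.< p →
                g ^ (2 ℕ.^ a ℕ.* q) ≡ -1ℤ [mod + p ] → ¬ g ^ (2 ℕ.^ suc a) ≡ 1ℤ [mod + p ] → PrimitiveRoot g p
primitiveRoot {q = q} {g} a pp pq refl 2<p g^h≡-1 g^2ᵃ≢1 = ∣⇒∣ᵤ (diff g^2h≡1) , minimal
  where
  n = 2 ℕ.^ suc a ℕ.* q
  p = suc n
  g^2h≡1 : g ^ n ≡ 1ℤ [mod + p ]
  g^2h≡1 = ≡mod-trans (≡mod-reflexive (trans (cong (g ^_) (trans (ℕ.*-assoc 2 (2 ℕ.^ a) q) (ℕ.*-comm 2 (2 ℕ.^ a ℕ.* q))))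
    (sym (ℤ.^-*-assoc g (2 ℕ.^ a ℕ.* q) 2)))) (^-cong-mod 2 g^h≡-1)
  minimal : ∀ k → 1 ℕ.≤ k → k ℕ.< n → ¬ (+ p) ℤᵤ.∣ (g ^ k - 1ℤ)
  minimal k 1≤k k<n p∣ = excluded (q ℕ∣.∣? d)
    where
    -- Passing to the gcd replaces an arbitrary exponent by a proper divisor of p - 1.
    d = gcd k n
    g^d≡1 : g ^ d ≡ 1ℤ [mod + p ]
    g^d≡1 = power-gcd {k = k} {n} (mod (∣ᵤ⇒∣ p∣)) g^2h≡1
    multiple : ∀ {m} → d ℕ∣.∣ m → g ^ m ≡ 1ℤ [mod + p ]
    multiple (ℕ∣.divides x m≡x*d) = subst (λ y → g ^ y ≡ 1ℤ [mod + p ]) (sym m≡x*d) (power-of-one x g^d≡1)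
    d<n : d ℕ.< n
    d<n = ℕ.≤-<-trans (ℕ∣.∣⇒≤ {{ℕ.>-nonZero 1≤k}} (gcd[m,n]∣m k n)) k<n
    excluded : Dec (q ℕ∣.∣ d) → ⊥
    -- Here d = c q with `c` a proper divisor of 2ᵃ⁺¹, so d divides (p - 1)/2, where the power of
    -- `g` is -1.
    excluded (yes (ℕ∣.divides c d≡c*q)) = 1≢-1-mod 2<p (≡mod-trans (≡mod-sym (multiple {2 ℕ.^ a ℕ.* q}
        (subst (ℕ∣._∣ 2 ℕ.^ a ℕ.* q) (sym d≡c*q) (ℕ∣.*-monoˡ-∣ q (proper-divisor-2^ {c} a
          (ℕ∣.*-cancelʳ-∣ {c} q {{prime⇒nonZero pq}} (subst (ℕ∣._∣ n) d≡c*q (gcd[m,n]∣n k n)))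
          (λ c≡2^ → ℕ.<⇒≢ d<n (trans d≡c*q (cong (ℕ._* q) c≡2^)))))))) g^h≡-1)
    -- Here d is prime to `q`, so it divides 2ᵃ⁺¹.
    excluded (no q∤d) = g^2ᵃ≢1 (multiple {2 ℕ.^ suc a} (Coprime.coprime-divisor coprime
        (subst (d ℕ∣.∣_) (ℕ.*-comm (2 ℕ.^ suc a) q) (gcd[m,n]∣n k n))))
      where
      coprime : Coprime.Coprime d q
      coprime (e∣d , e∣q) with prime⇒irreducible pq e∣q
      ... | inj₁ e≡1  = e≡1
      ... | inj₂ refl = contradiction e∣d q∤d

-- Applying the tuplets conjecture.

∏≡prod : ∀ k (f : Fin k → ℤ) → ∏ k f ≡ prod f
∏≡prod zero    f = refl
∏≡prod (suc k) f = cong (f zero *_) (∏≡prod k (f ∘ suc))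

-- Each linear form vanishes modulo p in at most one of k + 1 consecutive places when p > k.
common-nonroot : ∀ {p k} (α β : Fin k → ℕ) → Prime p → k ℕ.< p → (∀ j → ¬ p ℕ∣.∣ α j) →
                 ∃[ x ] (∀ j → ¬ p ℕ∣.∣ α j ℕ.* x ℕ.+ β j)
common-nonroot {p} {k} α β pp k<p p∤α = from-dec (Fin.all? root?)
  where
  Root : Fin (suc k) → Set
  Root x = ∃[ j ] p ℕ∣.∣ α j ℕ.* toℕ x ℕ.+ β j
  root? : ∀ x → Dec (Root x)
  root? x = Fin.any? (λ j → p ℕ∣.∣? (α j ℕ.* toℕ x ℕ.+ β j))
  clash : ∀ {x y} j → x ℕ.< y → y ℕ.≤ k → p ℕ∣.∣ α j ℕ.* x ℕ.+ β j → ¬ p ℕ∣.∣ α j ℕ.* y ℕ.+ β j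
  clash {x} {y} j x<y y≤k dx dy = [ p∤α j , <⇒∤ (ℕ.m<n⇒0<n∸m x<y) (ℕ.≤-<-trans (ℕ.≤-trans (ℕ.m∸n≤m y x) y≤k) k<p) ]′
    (euclidsLemma (α j) (y ℕ.∸ x) pp (ℕ∣.∣m+n∣m⇒∣n (subst (p ℕ∣.∣_) shift dy) dx))
    where
    regroup : ∀ a b x d → a ℕ.* (x ℕ.+ d) ℕ.+ b ≡ (a ℕ.* x ℕ.+ b) ℕ.+ a ℕ.* d
    regroup = ℕ-ring
    shift : α j ℕ.* y ℕ.+ β j ≡ (α j ℕ.* x ℕ.+ β j) ℕ.+ α j ℕ.* (y ℕ.∸ x)
    shift = trans (cong (λ z → α j ℕ.* z ℕ.+ β j) (sym (ℕ.m+[n∸m]≡n (ℕ.<⇒≤ x<y)))) (regroup (α j) (β j) x (y ℕ.∸ x))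
  from-dec : Dec (∀ x → Root x) → ∃[ x ] (∀ j → ¬ p ℕ∣.∣ α j ℕ.* x ℕ.+ β j)
  from-dec (no ¬all) = let x , ¬root = Fin.¬∀⟶∃¬ (suc k) Root root? ¬all in toℕ x , λ j d → ¬root (j , d)
  from-dec (yes roots) with x , y , x<y , same ← Fin.pigeonhole (ℕ.n<1+n k) (proj₁ ∘ roots) =
    contradiction (subst (λ j → p ℕ∣.∣ α j ℕ.* toℕ y ℕ.+ β j) (sym same) (proj₂ (roots y)))
      (clash (proj₁ (roots x)) x<y (ℕ.s≤s⁻¹ (Fin.toℕ<n y)) (proj₂ (roots x)))

pos-linear : ∀ a x b → + a * + x + + b ≡ + (a ℕ.* x ℕ.+ b)
pos-linear a x b = trans (cong (_+ + b) (sym (ℤ.pos-* a x))) (sym (ℤ.pos-+ (a ℕ.* x) b))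

admissible : ∀ k (α β : Fin k → ℕ) →
             (∀ p → Prime p → (∀ j → ¬ p ℕ∣.∣ β j) ⊎ (k ℕ.< p × (∀ j → ¬ p ℕ∣.∣ α j))) →
             Admissible k (λ j → + α j) (λ j → + β j)
admissible k α β cases p pp = let x , p∤ = nonroot in + x , λ d →
    ∤-prod (λ j → + α j * + x + + β j) pp (λ j → p∤ j ∘ subst (p ℕ∣.∣_) (cong ∣_∣ (pos-linear (α j) x (β j))) ∘ ∣⇒∣ᵤ)
      (subst (+ p ℤ∣.∣_) (∏≡prod k _) (∣ᵤ⇒∣ d))
  where
  nonroot : ∃[ x ] (∀ j → ¬ p ℕ∣.∣ α j ℕ.* x ℕ.+ β j)
  nonroot with cases p pp
  ... | inj₁ p∤β         = 0 , λ j → p∤β j ∘ subst (λ y → p ℕ∣.∣ y ℕ.+ β j) (ℕ.*-zeroʳ (α j))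
  ... | inj₂ (k<p , p∤α) = common-nonroot α β pp k<p p∤α

prime-pos : ∀ {n} → IsPrimeℤ (+ n) → Prime n
prime-pos (p , pp , n≡p) = subst Prime (sym (ℤ.+-injective n≡p)) pp

prime-power∤ : ∀ {l m} → Prime l → ¬ l ℕ∣.∣ m → ∀ n → ¬ l ℕ∣.∣ m ℕ.^ n
prime-power∤ pl l∤m zero    d = ¬prime[1] (subst Prime (ℕ∣.∣1⇒≡1 d) pl)
prime-power∤ pl l∤m (suc n) d = [ l∤m , prime-power∤ pl l∤m n ]′ (euclidsLemma _ _ pl d)

-- The forms M x + (M n² + r) and 2ᵃ⁺¹ (M x + M n² + r) + 1 for n = 1, …, N are made simultaneously prime.
module _ (N : ℕ) (1≤N : 1 ℕ.≤ N) (tc : TC (2 ℕ.* N)) (g : ℤ) (a M r B : ℕ)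
         (smooth : ∀ {l} → Prime l → l ℕ.≤ 2 ℕ.* N → l ℕ∣.∣ M)
         (coprime : ∀ {l} → Prime l → l ℕ∣.∣ M → ¬ l ℕ∣.∣ r × ¬ l ℕ∣.∣ suc (2 ℕ.^ suc a ℕ.* r))
         (0<M : 0 ℕ.< M)
         (root : ∀ {p q} z → Prime p → Prime q → p ≡ suc (2 ℕ.^ suc a ℕ.* q) → q ≡ M ℕ.* z ℕ.+ r → B ℕ.≤ p →
                 PrimitiveRoot g p) where

  private
    c : ℕ
    c = 2 ℕ.^ suc a
    2∣M : 2 ℕ∣.∣ M
    2∣M = smooth prime[2] (ℕ.*-monoʳ-≤ 2 1≤N)
    α′ : Fin 2 → ℕ
    α′ zero       = M
    α′ (suc zero) = c ℕ.* M
    β′ : Fin 2 → ℕ → ℕ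
    β′ zero       n = M ℕ.* (n ℕ.* n) ℕ.+ r
    β′ (suc zero) n = suc (c ℕ.* (M ℕ.* (n ℕ.* n) ℕ.+ r))
    -- An index encodes a pair: the kind of form (0 for qₙ, 1 for pₙ) and n - 1.
    α : Fin (2 ℕ.* N) → ℕ
    α j = α′ (proj₁ (remQuot {2} N j))
    β : Fin (2 ℕ.* N) → ℕ
    β j = β′ (proj₁ (remQuot {2} N j)) (suc (toℕ (proj₂ (remQuot {2} N j))))

    -- Modulo a prime of M the constant terms are r and 1 + c r, both prime to it. Any other prime
    -- exceeds 2N and, being odd because 2 divides M, divides no leading coefficient.
    cases : ∀ p → Prime p → (∀ j → ¬ p ℕ∣.∣ β j) ⊎ (2 ℕ.* N ℕ.< p × (∀ j → ¬ p ℕ∣.∣ α j))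
    cases p pp with p ℕ∣.∣? M
    ... | yes p∣M = inj₁ λ j → p∤β (proj₁ (remQuot {2} N j)) _
      where
      p∤β : ∀ b n → ¬ p ℕ∣.∣ β′ b n
      p∤β zero       n d = proj₁ (coprime pp p∣M) (ℕ∣.∣m+n∣m⇒∣n d (ℕ∣.∣m⇒∣m*n _ p∣M))
      p∤β (suc zero) n d = proj₂ (coprime pp p∣M) (ℕ∣.∣m+n∣m⇒∣n (subst (p ℕ∣.∣_) (split c M (n ℕ.* n) r) d)
          (ℕ∣.∣n⇒∣m*n c (ℕ∣.∣m⇒∣m*n (n ℕ.* n) p∣M)))
        where
        split : ∀ c M n r → 1 ℕ.+ c ℕ.* (M ℕ.* n ℕ.+ r) ≡ c ℕ.* (M ℕ.* n) ℕ.+ (1 ℕ.+ c ℕ.* r)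
        split = ℕ-ring
    ... | no p∤M = inj₂ (ℕ.≰⇒> (p∤M ∘ smooth pp) , λ j → p∤α (proj₁ (remQuot {2} N j)))
      where
      p∤2 : ¬ p ℕ∣.∣ 2
      p∤2 d = p∤M (ℕ∣.∣-trans d 2∣M)
      p∤α : ∀ b → ¬ p ℕ∣.∣ α′ b
      p∤α zero       = p∤M
      p∤α (suc zero) = [ prime-power∤ pp p∤2 (suc a) , p∤M ]′ ∘ euclidsLemma c M pp

    positive : ∀ j → + 0 ℤ.< + α j
    positive j = ℤ.+<+ (0<α (proj₁ (remQuot {2} N j)))
      where
      0<α : ∀ b → 0 ℕ.< α′ b
      0<α zero       = 0<M
      0<α (suc zero) = ℕ.*-mono-< (ℕ.m^n>0 2 (suc a)) 0<M

    -- The conjecture bounds only the absolute value of x. At x = -(y + 1) the form for n = 1 equals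
    -- r - M y, which is negative once y > r.
    too-negative : ∀ {y n} → suc r ℕ.≤ y → ¬ (+ M * -[1+ y ] + + (M ℕ.* 1 ℕ.+ r) ≡ + n)
    too-negative {y} {n} r<y eq = ℕ.<⇒≱ (ℕ.≤-trans r<y (ℕ.m≤n*m y M {{ℕ.>-nonZero 0<M}})) (ℕ.+-cancelˡ-≤ M _ _
        (subst₂ ℕ._≤_ (ℕ.*-suc M y) (cong (ℕ._+ r) (ℕ.*-identityʳ M)) (subst (M ℕ.* suc y ℕ.≤_) (sym eq′) (ℕ.m≤n+m _ n))))
      where
      move : ∀ m y s → s ≡ (m * - y + s) + m * y
      move = ℤ-ring
      eq′ : M ℕ.* 1 ℕ.+ r ≡ n ℕ.+ M ℕ.* suc y
      eq′ = ℤ.+-injective (trans (move (+ M) (+ suc y) (+ (M ℕ.* 1 ℕ.+ r)))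
        (trans (cong (_+ + M * + suc y) eq) (trans (cong (λ x → + n + x) (sym (ℤ.pos-* M (suc y))))
          (sym (ℤ.pos-+ n (M ℕ.* suc y))))))

    PrimeAt : ℤ → Set
    PrimeAt x = (j : Fin (2 ℕ.* N)) → IsPrimeℤ (+ α j * x + + β j)

    at-combine : ∀ {x} → PrimeAt x → ∀ b (i : Fin N) → IsPrimeℤ (+ α′ b * x + + β′ b (suc (toℕ i)))
    at-combine {x} primes b i = subst (λ j → IsPrimeℤ (+ α′ (proj₁ j) * x + + β′ (proj₁ j) (suc (toℕ (proj₂ j)))))
      (Fin.remQuot-combine {2} {N} b i) (primes (combine {2} {N} b i))

    nonnegative : ∀ x → suc (suc r) ℕ.+ B ℕ.≤ ∣ x ∣ → PrimeAt x → ∃[ y ] x ≡ + y × B ℕ.≤ y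
    nonnegative (+ y)    large primes = y , refl , ℕ.≤-trans (ℕ.m≤n+m B (suc (suc r))) large
    nonnegative -[1+ y ] large primes = contradiction
      (proj₂ (proj₂ (at-combine { -[1+ y ] } primes zero (fromℕ< 1≤N))))
      (subst (λ k → ¬ + M * -[1+ y ] + + (M ℕ.* (suc k ℕ.* suc k) ℕ.+ r) ≡ + proj₁ (at-combine { -[1+ y ] } primes zero (fromℕ< 1≤N)))
        (sym (Fin.toℕ-fromℕ< 1≤N))
        (too-negative (ℕ.s≤s⁻¹ (ℕ.≤-trans (ℕ.m≤m+n (suc (suc r)) B) large))))

  quadratic-progression : ∃[ A₁ ] ∃[ C₁ ] ((n : ℕ) → 1 ℕ.≤ n → n ℕ.≤ N →
    Σ ℕ λ p → (A₁ * (+ n) * (+ n) + C₁ ≡ + p) × Prime p × PrimitiveRoot g p)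
  quadratic-progression with x , large , primes ←
      -- An absolute value of at least r + 2 rules out negative x, as just shown; the summand `B`
      -- makes every pₙ at least `B`.
      tc (λ j → + α j) (λ j → + β j) positive (admissible (2 ℕ.* N) α β cases) (suc (suc r) ℕ.+ B)
    with y , refl , B≤y ← nonnegative x large primes
    -- Coefficients of 1 + c (M (n² + y) + r) as a polynomial in n.
    = + (c ℕ.* M) , + (c ℕ.* M ℕ.* y ℕ.+ suc (c ℕ.* r)) , values
    where
    values : (n : ℕ) → 1 ℕ.≤ n → n ℕ.≤ N → Σ ℕ λ p →
      (+ (c ℕ.* M) * (+ n) * (+ n) + + (c ℕ.* M ℕ.* y ℕ.+ suc (c ℕ.* r)) ≡ + p) × Prime p × PrimitiveRoot g p
    values n@(suc m) _ m<N = suc (c ℕ.* q) , value ,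
        pp , root (y ℕ.+ n ℕ.* n) pp (subst Prime (q-eq M y (n ℕ.* n) r) (prime-form zero)) refl refl B≤p
      where
      q : ℕ
      q = M ℕ.* (y ℕ.+ n ℕ.* n) ℕ.+ r
      prime-form : ∀ b → Prime (α′ b ℕ.* y ℕ.+ β′ b n)
      prime-form b = prime-pos (subst IsPrimeℤ (pos-linear (α′ b) y (β′ b n))
        (subst (λ k → IsPrimeℤ (+ α′ b * + y + + β′ b (suc k))) (Fin.toℕ-fromℕ< m<N) (at-combine {+ y} primes b (fromℕ< m<N))))
      q-eq : ∀ M y n r → M ℕ.* y ℕ.+ (M ℕ.* n ℕ.+ r) ≡ M ℕ.* (y ℕ.+ n) ℕ.+ r
      q-eq = ℕ-ring
      p-eq : ∀ c M y n r → c ℕ.* M ℕ.* y ℕ.+ (1 ℕ.+ c ℕ.* (M ℕ.* n ℕ.+ r)) ≡ 1 ℕ.+ c ℕ.* (M ℕ.* (y ℕ.+ n) ℕ.+ r)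
      p-eq = ℕ-ring
      value-eq : ∀ c M y n r → c ℕ.* M ℕ.* n ℕ.* n ℕ.+ (c ℕ.* M ℕ.* y ℕ.+ (1 ℕ.+ c ℕ.* r)) ≡ 1 ℕ.+ c ℕ.* (M ℕ.* (y ℕ.+ n ℕ.* n) ℕ.+ r)
      value-eq = ℕ-ring
      pp : Prime (suc (c ℕ.* q))
      pp = subst Prime (p-eq c M y (n ℕ.* n) r) (prime-form (suc zero))
      value : + (c ℕ.* M) * (+ n) * (+ n) + + (c ℕ.* M ℕ.* y ℕ.+ suc (c ℕ.* r)) ≡ + suc (c ℕ.* q)
      value = trans (cong (λ z → z * + n + + (c ℕ.* M ℕ.* y ℕ.+ suc (c ℕ.* r))) (sym (ℤ.pos-* (c ℕ.* M) n)))
        (trans (pos-linear (c ℕ.* M ℕ.* n) n _) (cong +_ (value-eq c M y n r)))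
      B≤p : B ℕ.≤ suc (c ℕ.* q)
      B≤p = begin
        B                                     ≤⟨ B≤y ⟩
        y                                     ≤⟨ ℕ.m≤m+n y (n ℕ.* n) ⟩
        y ℕ.+ n ℕ.* n                         ≤⟨ ℕ.m≤n*m (y ℕ.+ n ℕ.* n) M {{ℕ.>-nonZero 0<M}} ⟩
        M ℕ.* (y ℕ.+ n ℕ.* n)                 ≤⟨ ℕ.m≤m+n _ r ⟩
        q                                     ≤⟨ ℕ.m≤n*m q c {{ℕ.m^n≢0 2 (suc a)}} ⟩
        c ℕ.* q                               ≤⟨ ℕ.n≤1+n _ ⟩
        suc (c ℕ.* q)                         ∎
        where open ℕ.≤-Reasoning

-- Squarefree parts, auxiliary moduli and linear congruences.

-- By strong induction, a square l² dividing `n` is moved into s. The search for l may stop at `n`,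
-- as l² ∣ n gives l ≤ n.
squarefree-decomposition : ∀ n → 0 ℕ.< n → ∃[ d ] ∃[ s ] n ≡ d ℕ.* (s ℕ.* s) × (∀ {l} → Prime l → ¬ l ℕ.* l ℕ∣.∣ d)
squarefree-decomposition = <-rec _ step
  where
  Decomposition : ℕ → Set
  Decomposition n = ∃[ d ] ∃[ s ] n ≡ d ℕ.* (s ℕ.* s) × (∀ {l} → Prime l → ¬ l ℕ.* l ℕ∣.∣ d)
  step : ∀ n → (∀ {m} → m ℕ.< n → 0 ℕ.< m → Decomposition m) → 0 ℕ.< n → Decomposition n
  step n rec 0<n with Fin.any? {suc n} (λ i → prime? (toℕ i) ×-dec (toℕ i ℕ.* toℕ i ℕ∣.∣? n))
  ... | no none = n , 1 , sym (ℕ.*-identityʳ n) , λ {l} pl l²∣n →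
    let l≤n = ℕ.≤-trans (ℕ.m≤m*n l l {{prime⇒nonZero pl}}) (ℕ∣.∣⇒≤ {{ℕ.>-nonZero 0<n}} l²∣n) in
    none (fromℕ< (s≤s l≤n) , subst (λ x → Prime x × x ℕ.* x ℕ∣.∣ n) (sym (Fin.toℕ-fromℕ< (s≤s l≤n))) (pl , l²∣n))
  ... | yes (i , pl , ℕ∣.divides zero    n≡) = contradiction (sym n≡) (ℕ.<⇒≢ 0<n)
  ... | yes (i , pl , ℕ∣.divides e@(suc _) n≡) =
    let d , s , e≡ , d-free = rec {e} e<n ℕ.z<s in
    d , s ℕ.* l , trans n≡ (trans (cong (ℕ._* (l ℕ.* l)) e≡) (regroup d s l)) , d-free
    where
    l = toℕ i
    regroup : ∀ d s l → d ℕ.* (s ℕ.* s) ℕ.* (l ℕ.* l) ≡ d ℕ.* (s ℕ.* l ℕ.* (s ℕ.* l))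
    regroup = ℕ-ring
    1<l : 1 ℕ.< l
    1<l = ℕ.nonTrivial⇒n>1 l {{prime⇒nonTrivial pl}}
    e<n : e ℕ.< n
    e<n = subst (e ℕ.<_) (sym n≡) (ℕ.m<m*n e (l ℕ.* l) {{ℕ.>-nonZero ℕ.z<s}} (ℕ.*-mono-< 1<l 1<l))

-- Supplies the part of the modulus where p ≡ 9 is imposed; `ls` lists the primes at which the
-- residue is prescribed separately.
coprime-primorial : ∀ ls → All Prime ls → ∀ b →
  ∃[ K ] 0 ℕ.< K × (∀ {l} → Prime l → l ℕ.≤ b → l ∉ ls → l ℕ∣.∣ K) × (∀ {l} → l ∈ ls → ¬ l ℕ∣.∣ K)
coprime-primorial ls pls zero = 1 , ℕ.z<s , (λ pl l≤0 _ → contradiction (subst Prime (ℕ.n≤0⇒n≡0 l≤0) pl) ¬prime[0]) ,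
  λ l∈ls l∣1 → ¬prime[1] (subst Prime (ℕ∣.∣1⇒≡1 l∣1) (All.lookup pls l∈ls))
coprime-primorial ls pls (suc b)
  with K , 0<K , all , none ← coprime-primorial ls pls b
  with prime? (suc b) ×-dec ¬? (suc b ∈? ls)
... | yes (pb , b∉ls) = suc b ℕ.* K , ℕ.*-mono-< (ℕ.z<s {b}) 0<K ,
    (λ pl l≤ l∉ → [ (λ l<1+b → ℕ∣.∣n⇒∣m*n (suc b) (all pl (ℕ.s≤s⁻¹ l<1+b) l∉)) , (λ { refl → ℕ∣.m∣m*n K }) ]′ (ℕ.m≤n⇒m<n∨m≡n l≤)) ,
    λ l∈ls → [ (λ l∣1+b → b∉ls (subst (_∈ ls) (prime∣prime⇒≡ (All.lookup pls l∈ls) pb l∣1+b) l∈ls)) , none l∈ls ]′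
      ∘ euclidsLemma (suc b) K (All.lookup pls l∈ls)
... | no excluded = K , 0<K ,
    (λ pl l≤ l∉ → [ (λ l<1+b → all pl (ℕ.s≤s⁻¹ l<1+b) l∉) , (λ { refl → contradiction (pl , l∉) excluded }) ]′ (ℕ.m≤n⇒m<n∨m≡n l≤)) ,
    none

-- c²ʲ⁻¹ (u + 2j b) is a solution since c²ʲ ≡ 1 and 2j ≡ -1 modulo l = 2j + 1.
solve-linear : ∀ {l} j → l ≡ suc (2 ℕ.* j) → Prime l → ∀ b c u → ¬ l ℕ∣.∣ c → ∃[ t ] + (b ℕ.+ c ℕ.* t) ≡ + u [mod + l ]
solve-linear         zero      refl pl b c u l∤c = contradiction pl ¬prime[1]
solve-linear {l} j@(suc i) l≡1+2j pl b c u l∤c = t , (begin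
    + (b ℕ.+ c ℕ.* t)                      ≡⟨ cong (λ x → + (b ℕ.+ x)) (ℕ.*-assoc c (c ℕ.^ ℕ.pred (2 ℕ.* j)) w) ⟨
    + (b ℕ.+ c ℕ.^ (2 ℕ.* j) ℕ.* w)        ≡⟨ trans (ℤ.pos-+ b _) (cong (λ x → + b + x) (ℤ.pos-* (c ℕ.^ (2 ℕ.* j)) w)) ⟩
    + b + + (c ℕ.^ (2 ℕ.* j)) * + w        ≡⟨ cong (λ x → + b + x * + w) (pos-^ c (2 ℕ.* j)) ⟩
    + b + (+ c) ^ (2 ℕ.* j) * + w          ≈⟨ +-cong-mod (≡mod-refl {a = + b}) (*-cong-mod (fermat j {{prime⇒nonZero pl}} l≡1+2j pl l∤c) (≡mod-refl {a = + w})) ⟩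
    + b + 1ℤ * + w                         ≡⟨ cong (λ x → + b + x) (ℤ.*-identityˡ (+ w)) ⟩
    + b + + w                              ≡⟨ trans (sym (ℤ.pos-+ b w)) (trans (cong +_ total) (trans (ℤ.pos-+ u (b ℕ.* l)) (cong (λ x → + u + x) (ℤ.pos-* b l)))) ⟩
    + u + + b * + l                        ≈⟨ ≡mod-by (+ b) refl ⟩
    + u                                    ∎)
  where
  open ≡mod-Reasoning (+ l)
  w t : ℕ
  w = u ℕ.+ 2 ℕ.* j ℕ.* b
  t = c ℕ.^ ℕ.pred (2 ℕ.* j) ℕ.* w
  pos-^ : ∀ c n → + (c ℕ.^ n) ≡ (+ c) ^ n
  pos-^ c zero    = refl
  pos-^ c (suc n) = trans (ℤ.pos-* c (c ℕ.^ n)) (cong (+ c *_) (pos-^ c n))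
  rearrange : ∀ b u j → b ℕ.+ (u ℕ.+ j ℕ.* b) ≡ u ℕ.+ b ℕ.* (1 ℕ.+ j)
  rearrange = ℕ-ring
  total : b ℕ.+ w ≡ u ℕ.+ b ℕ.* l
  total = trans (rearrange b u (2 ℕ.* j)) (cong (λ x → u ℕ.+ b ℕ.* x) (sym l≡1+2j))

square-mod-3 : ∀ {K} → ¬ 3 ℕ∣.∣ K → ∃[ f ] K ℕ.* K ≡ 1 ℕ.+ 3 ℕ.* f
square-mod-3 {K} 3∤K = go {K ℕ./ 3} (K ℕ.% 3) (m%n<n K 3) (m≡m%n+[m/n]*n K 3)
  where
  go : ∀ {e} r → r ℕ.< 3 → K ≡ r ℕ.+ e ℕ.* 3 → ∃[ f ] K ℕ.* K ≡ 1 ℕ.+ 3 ℕ.* f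
  go {e} 0 _ refl = contradiction (ℕ∣.n∣m*n e) 3∤K
  go {e} 1 _ refl = 3 ℕ.* e ℕ.* e ℕ.+ 2 ℕ.* e , expand e
    where
    expand : ∀ e → (1 ℕ.+ e ℕ.* 3) ℕ.* (1 ℕ.+ e ℕ.* 3) ≡ 1 ℕ.+ 3 ℕ.* (3 ℕ.* e ℕ.* e ℕ.+ 2 ℕ.* e)
    expand = ℕ-ring
  go {e} 2 _ refl = 3 ℕ.* e ℕ.* e ℕ.+ 4 ℕ.* e ℕ.+ 1 , expand e
    where
    expand : ∀ e → (2 ℕ.+ e ℕ.* 3) ℕ.* (2 ℕ.+ e ℕ.* 3) ≡ 1 ℕ.+ 3 ℕ.* (3 ℕ.* e ℕ.* e ℕ.+ 4 ℕ.* e ℕ.+ 1)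
    expand = ℕ-ring
  go (suc (suc (suc _))) (s≤s (s≤s (s≤s ()))) _

prime-divisor : ∀ n .{{_ : NonZero n}} → n ≢ 1 → ∃[ l ] Prime l × l ℕ∣.∣ n
prime-divisor n n≢1 = head factors factorsPrime isFactorisation
  where
  open PrimeFactorisation (factorise n)
  head : ∀ ls → All Prime ls → n ≡ product ls → ∃[ l ] Prime l × l ℕ∣.∣ n
  head []       _        n≡1 = contradiction n≡1 n≢1
  head (l ∷ ls) (pl ∷ _) n≡  = l , pl , subst (l ℕ∣.∣_) (sym n≡) (ℕ∣.m∣m*n (product ls))

∤-+ʳ : ∀ {l m n} → ¬ l ℕ∣.∣ m → l ℕ∣.∣ n → ¬ l ℕ∣.∣ m ℕ.+ n
∤-+ʳ {l} {m} {n} l∤m l∣n d = l∤m (ℕ∣.∣m+n∣m⇒∣n (subst (l ℕ∣.∣_) (ℕ.+-comm m n) d) l∣n)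

∤-+ˡ : ∀ {l m n} → l ℕ∣.∣ m → ¬ l ℕ∣.∣ n → ¬ l ℕ∣.∣ m ℕ.+ n
∤-+ˡ l∣m l∤n d = l∤n (ℕ∣.∣m+n∣m⇒∣n d l∣m)

∤-* : ∀ {l m n} → Prime l → ¬ l ℕ∣.∣ m → ¬ l ℕ∣.∣ n → ¬ l ℕ∣.∣ m ℕ.* n
∤-* pl l∤m l∤n = [ l∤m , l∤n ]′ ∘ euclidsLemma _ _ pl

pos-mod : ∀ {n m x l} → l ℕ∣.∣ x → n ≡ m ℕ.+ x → + n ≡ + m [mod + l ]
pos-mod {n} {m} {x} {l} (ℕ∣.divides w x≡) n≡ = ≡mod-by (+ w)
  (trans (cong +_ (trans n≡ (cong (m ℕ.+_) x≡))) (trans (ℤ.pos-+ m (w ℕ.* l)) (cong (λ y → + m + y) (ℤ.pos-* w l))))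

odd⇒ε≡-1 : ∀ {n} → ¬ 2 ℕ∣.∣ n → ε n ≡ -1ℤ
odd⇒ε≡-1 {n} 2∤n with even-or-odd n
... | j , inj₁ refl = contradiction (ℕ∣.m∣m*n j) 2∤n
... | j , inj₂ refl = trans (ε-suc (2 ℕ.* j)) (cong (-1ℤ *_) (ε-double j))

abs-^ : ∀ i n → ∣ i ^ n ∣ ≡ ∣ i ∣ ℕ.^ n
abs-^ i zero    = refl
abs-^ i (suc n) = trans (ℤ.abs-* i (i ^ n)) (cong (∣ i ∣ ℕ.*_) (abs-^ i n))

-- The residue class of q.

-- The residue r modulo 6K of the primes q = (p - 1)/2ᵃ⁺¹ is chosen with 1 + 2ᵃ⁺¹ r ≡ 9 modulo K,
-- so that every prime l ∣ K satisfies (p/l) = (9/l) = 1.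
module _ {K : ℕ} (2∤K : ¬ 2 ℕ∣.∣ K) (3∤K : ¬ 3 ℕ∣.∣ K) (a r₀ r₁ t : ℕ) (8≡ : 2 ℕ.^ suc a ℕ.* r₀ ≡ 8) where

  -- K² ≡ 1 modulo 3, so K² (1 + 3t) is 1 modulo 3 and 0 modulo `K`. Modulo 3 only r₀ + r₁ matters,
  -- and `t` stays free for adjustment modulo one further prime.
  residue : ℕ
  residue = r₀ ℕ.+ r₁ ℕ.* (K ℕ.* K ℕ.* (1 ℕ.+ 3 ℕ.* t))

  residue-9 : suc (2 ℕ.^ suc a ℕ.* residue) ≡ 9 ℕ.+ 2 ℕ.^ suc a ℕ.* r₁ ℕ.* (K ℕ.* K ℕ.* (1 ℕ.+ 3 ℕ.* t))
  residue-9 = trans (expand (2 ℕ.^ suc a) r₀ r₁ _) (cong (λ x → suc (x ℕ.+ 2 ℕ.^ suc a ℕ.* r₁ ℕ.* (K ℕ.* K ℕ.* (1 ℕ.+ 3 ℕ.* t)))) 8≡)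
    where
    expand : ∀ c r₀ r₁ x → 1 ℕ.+ c ℕ.* (r₀ ℕ.+ r₁ ℕ.* x) ≡ 1 ℕ.+ (c ℕ.* r₀ ℕ.+ c ℕ.* r₁ ℕ.* x)
    expand = ℕ-ring

  -- Modulo a prime of `K` the two numbers are r₀, a divisor of 8, and 9, and `K` is prime to 6.
  -- Modulo 3 they are r₀ + r₁ and 9 + 2ᵃ⁺¹ r₁.
  residue-coprime : ¬ 2 ℕ∣.∣ residue → ¬ 3 ℕ∣.∣ r₀ ℕ.+ r₁ → ¬ 3 ℕ∣.∣ 9 ℕ.+ 2 ℕ.^ suc a ℕ.* r₁ →
                    ∀ {l} → Prime l → l ≡ 2 ⊎ l ≡ 3 ⊎ l ℕ∣.∣ K →
                    ¬ l ℕ∣.∣ residue × ¬ l ℕ∣.∣ suc (2 ℕ.^ suc a ℕ.* residue)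
  residue-coprime 2∤r 3∤r 3∤c pl (inj₁ refl) = 2∤r ,
    ∤-+ʳ {2} {1} (<⇒∤ ℕ.z<s (s≤s (s≤s z≤n))) (ℕ∣.∣m⇒∣m*n residue (ℕ∣.m∣m*n (2 ℕ.^ a)))
  residue-coprime 2∤r 3∤r 3∤c pl (inj₂ (inj₁ refl)) =
      (λ d → ∤-+ʳ 3∤r (ℕ∣.m∣m*n (r₁ ℕ.* (f ℕ.+ t ℕ.+ 3 ℕ.* f ℕ.* t))) (subst (3 ℕ∣.∣_) (mod-3 r₀ r₁) d)) ,
      (λ d → ∤-+ʳ 3∤c (ℕ∣.m∣m*n (2 ℕ.^ suc a ℕ.* r₁ ℕ.* (f ℕ.+ t ℕ.+ 3 ℕ.* f ℕ.* t))) (subst (3 ℕ∣.∣_) (trans residue-9 (mod-3 9 (2 ℕ.^ suc a ℕ.* r₁))) d))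
    where
    f : ℕ
    f = proj₁ (square-mod-3 3∤K)
    expand : ∀ b c f t → b ℕ.+ c ℕ.* ((1 ℕ.+ 3 ℕ.* f) ℕ.* (1 ℕ.+ 3 ℕ.* t)) ≡
             b ℕ.+ c ℕ.+ 3 ℕ.* (c ℕ.* (f ℕ.+ t ℕ.+ 3 ℕ.* f ℕ.* t))
    expand = ℕ-ring
    mod-3 : ∀ b c → b ℕ.+ c ℕ.* (K ℕ.* K ℕ.* (1 ℕ.+ 3 ℕ.* t)) ≡ b ℕ.+ c ℕ.+ 3 ℕ.* (c ℕ.* (f ℕ.+ t ℕ.+ 3 ℕ.* f ℕ.* t))
    mod-3 b c = trans (cong (λ x → b ℕ.+ c ℕ.* (x ℕ.* (1 ℕ.+ 3 ℕ.* t))) (proj₂ (square-mod-3 3∤K))) (expand b c f t)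
  residue-coprime 2∤r 3∤r 3∤c {l} pl (inj₂ (inj₂ l∣K)) =
      ∤-+ʳ l∤r₀ (ℕ∣.∣n⇒∣m*n r₁ l∣X) ,
      (λ d → ∤-+ʳ (∤-* {m = 3} {n = 3} pl l∤3 l∤3) (ℕ∣.∣n⇒∣m*n (2 ℕ.^ suc a ℕ.* r₁) l∣X) (subst (l ℕ∣.∣_) residue-9 d))
    where
    l∣X : l ℕ∣.∣ K ℕ.* K ℕ.* (1 ℕ.+ 3 ℕ.* t)
    l∣X = ℕ∣.∣m⇒∣m*n _ (ℕ∣.∣m⇒∣m*n K l∣K)
    l∤3 : ¬ l ℕ∣.∣ 3
    l∤3 d = 3∤K (subst (ℕ∣._∣ K) (prime∣prime⇒≡ pl prime[3] d) l∣K)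
    l∤2 : ¬ l ℕ∣.∣ 2
    l∤2 d = 2∤K (subst (ℕ∣._∣ K) (prime∣prime⇒≡ pl prime[2] d) l∣K)
    l∤r₀ : ¬ l ℕ∣.∣ r₀
    l∤r₀ d = prime-power∤ pl l∤2 3 (subst (l ℕ∣.∣_) 8≡ (ℕ∣.∣n⇒∣m*n (2 ℕ.^ suc a) d))

-- The three cases for the squarefree part of |g|.

module _ (N : ℕ) (1≤N : 1 ℕ.≤ N) (tc : TC (2 ℕ.* N)) (g : ℤ) (g≢-1 : ¬ g ≡ -[1+ 0 ]) (g-nonsquare : ¬ IsSquareℤ g) where

  Progression : Set
  Progression = ∃[ A₁ ] ∃[ C₁ ] ((n : ℕ) → 1 ℕ.≤ n → n ℕ.≤ N →
    Σ ℕ λ p → (A₁ * (+ n) * (+ n) + C₁ ≡ + p) × Prime p × PrimitiveRoot g p)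

  G : ℕ
  G = ∣ g ∣

  G≢1 : G ≢ 1
  G≢1 G≡1 = let s , s± , g≡ = signPart g in
      [ (λ s≡1 → g-nonsquare (1ℤ , trans g≡ (cong₂ (λ s x → s * + x) s≡1 G≡1)))
      , (λ s≡-1 → g≢-1 (trans g≡ (cong₂ (λ s x → s * + x) s≡-1 G≡1))) ]′ s±

  0<G : 0 ℕ.< G
  0<G = ℕ.n≢0⇒n>0 (λ G≡0 → g-nonsquare (0ℤ , ℤ.∣i∣≡0⇒i≡0 G≡0))

  from-nonresidue : ∀ a K r →
    (∀ {l} → Prime l → l ℕ.≤ 2 ℕ.* N → l ≢ 2 → l ≢ 3 → l ℕ∣.∣ K) → 0 ℕ.< K →
    (∀ {l} → Prime l → l ≡ 2 ⊎ l ≡ 3 ⊎ l ℕ∣.∣ K → ¬ l ℕ∣.∣ r × ¬ l ℕ∣.∣ suc (2 ℕ.^ suc a ℕ.* r)) →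
    (∀ {p q} z → Prime p → p ≡ suc (2 ℕ.* (2 ℕ.^ a ℕ.* q)) → q ≡ 6 ℕ.* K ℕ.* z ℕ.+ r → G ℕ.< p →
      g ^ (2 ℕ.^ a ℕ.* q) ≡ -1ℤ [mod + p ]) →
    Progression
  from-nonresidue a K r smooth 0<K coprime nonresidue-p =
    quadratic-progression N 1≤N tc g a (6 ℕ.* K) r B smooth6 (λ pl → coprime pl ∘ split pl) (ℕ.*-mono-< (ℕ.z<s {5}) 0<K) root
    where
    E B : ℕ
    E = ∣ g ^ (2 ℕ.^ suc a) - 1ℤ ∣
    -- Gives p > 2; p > |g|, so that p divides neither s nor d; and p > `E`, so that p does not
    -- divide the nonzero number `E`.
    B = 3 ℕ.+ (G ℕ.+ E)
    smooth6 : ∀ {l} → Prime l → l ℕ.≤ 2 ℕ.* N → l ℕ∣.∣ 6 ℕ.* K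
    smooth6 {l} pl l≤2N with l ℕ.≟ 2 | l ℕ.≟ 3
    ... | yes refl | _        = ℕ∣.∣m⇒∣m*n {2} {6} K (ℕ∣.divides 3 refl)
    ... | no _     | yes refl = ℕ∣.∣m⇒∣m*n {3} {6} K (ℕ∣.divides 2 refl)
    ... | no l≢2   | no l≢3   = ℕ∣.∣n⇒∣m*n 6 (smooth pl l≤2N l≢2 l≢3)
    split : ∀ {l} → Prime l → l ℕ∣.∣ 6 ℕ.* K → l ≡ 2 ⊎ l ≡ 3 ⊎ l ℕ∣.∣ K
    split pl d = [ (λ d6 → Sum.map (prime∣prime⇒≡ pl prime[2]) (inj₁ ∘ prime∣prime⇒≡ pl prime[3]) (euclidsLemma 2 3 pl d6))
                 , inj₂ ∘ inj₂ ]′ (euclidsLemma 6 K pl d)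
    -- A power of `g` with positive exponent equals 1 only if |g| = 1, which is excluded as `g` is
    -- neither -1 nor a square.
    0<E : 0 ℕ.< E
    0<E = ℕ.n≢0⇒n>0 λ E≡0 → [ (λ 2^≡0 → contradiction 2^≡0 (ℕ.≢-nonZero⁻¹ _ {{ℕ.m^n≢0 2 (suc a)}})) , G≢1 ]′
      (ℕ.m^n≡1⇒n≡0∨m≡1 G (2 ℕ.^ suc a)
        (trans (sym (abs-^ g (2 ℕ.^ suc a))) (cong ∣_∣ (ℤ.i-j≡0⇒i≡j (g ^ (2 ℕ.^ suc a)) 1ℤ (ℤ.∣i∣≡0⇒i≡0 E≡0)))))
    root : ∀ {p q} z → Prime p → Prime q → p ≡ suc (2 ℕ.^ suc a ℕ.* q) → q ≡ 6 ℕ.* K ℕ.* z ℕ.+ r → B ℕ.≤ p → PrimitiveRoot g p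
    root {p} {q} z pp pq p≡ q≡ B≤p = primitiveRoot a pp pq p≡ (ℕ.≤-trans (ℕ.m≤m+n 3 _) B≤p)
      (nonresidue-p z pp (trans p≡ (cong suc (ℕ.*-assoc 2 (2 ℕ.^ a) q))) q≡
        (ℕ.≤-trans (s≤s (ℕ.≤-trans (ℕ.m≤m+n G E) (ℕ.m≤n+m _ 2))) B≤p))
      (λ g^≡1 → <⇒∤ 0<E (ℕ.≤-trans (s≤s (ℕ.≤-trans (ℕ.m≤n+m E G) (ℕ.m≤n+m _ 2))) B≤p) (∣⇒∣ᵤ (diff g^≡1)))

  odd-residue-class : ∀ {q r} K z → q ≡ 6 ℕ.* K ℕ.* z ℕ.+ r → ¬ 2 ℕ∣.∣ r → ε q ≡ -1ℤ
  odd-residue-class K z refl 2∤r = odd⇒ε≡-1 (∤-+ˡ (ℕ∣.∣m⇒∣m*n z (ℕ∣.∣m⇒∣m*n {2} {6} K (ℕ∣.divides 3 refl))) 2∤r)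

  power-of-g : ∀ {p σ d} s h → p ≡ suc (2 ℕ.* h) → Prime p → G ℕ.< p → g ≡ σ * + G → G ≡ d ℕ.* (s ℕ.* s) →
               g ^ h ≡ σ ^ h * (+ d) ^ h [mod + p ]
  power-of-g {p} {σ} {d} s h p≡ pp G<p g≡ G≡ = ≡mod-trans
      (≡mod-reflexive (cong (_^ h) (trans g≡ (cong (λ x → σ * + x) G≡)))) (square-times-power h p≡ pp σ d s p∤s)
    where
    p∤s : ¬ p ℕ∣.∣ s
    p∤s d∣ = <⇒∤ 0<G G<p (subst (p ℕ∣.∣_) (sym G≡) (ℕ∣.∣n⇒∣m*n d (ℕ∣.∣m⇒∣m*n s d∣)))

  module _ {σ : ℤ} {d : ℕ} (s : ℕ) (σ± : IsSign σ) (g≡ : g ≡ σ * + G) (G≡ : G ≡ d ℕ.* (s ℕ.* s)) where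

    case-one : d ≡ 1 → ∀ K → 0 ℕ.< K → (∀ {l} → Prime l → l ℕ.≤ 2 ℕ.* N → l ≢ 2 → l ≢ 3 → l ℕ∣.∣ K) →
               ¬ 2 ℕ∣.∣ K → ¬ 3 ℕ∣.∣ K → Progression
    case-one refl K 0<K smooth 2∤K 3∤K = from-nonresidue 0 K r smooth 0<K
        -- 2 · 4 = 8; r is odd because r₀ = 4 is even and r₁ = 1 is odd; modulo 3 the values 4 + 1 =
        -- 5 and 9 + 2 · 1 = 11 are checked.
        (residue-coprime 2∤K 3∤K 0 4 1 0 refl 2∤r (from-no (3 ℕ∣.∣? 5)) (from-no (3 ℕ∣.∣? 11)))
        nonresidue-p
      where
      r : ℕ
      r = residue 2∤K 3∤K 0 4 1 0 refl
      2∤r : ¬ 2 ℕ∣.∣ r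
      2∤r = ∤-+ˡ {2} {4} (ℕ∣.divides 2 refl) (∤-* {m = 1} prime[2] (from-no (2 ℕ∣.∣? 1))
        (∤-* {n = 1} prime[2] (∤-* prime[2] 2∤K 2∤K) (from-no (2 ℕ∣.∣? 1))))
      σ≡-1 : σ ≡ -1ℤ
      σ≡-1 = [ (λ σ≡1 → contradiction (+ s , trans g≡ (trans (cong₂ (λ x y → x * + y) σ≡1 (trans G≡ (ℕ.*-identityˡ _)))
                 (trans (ℤ.*-identityˡ _) (ℤ.pos-* s s)))) g-nonsquare) , id ]′ σ±
      nonresidue-p : ∀ {p q} z → Prime p → p ≡ suc (2 ℕ.* (2 ℕ.^ 0 ℕ.* q)) → q ≡ 6 ℕ.* K ℕ.* z ℕ.+ r → G ℕ.< p →
                     g ^ (2 ℕ.^ 0 ℕ.* q) ≡ -1ℤ [mod + p ]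
      nonresidue-p {p} {q} z pp p≡ q≡ G<p = begin
          g ^ h                    ≈⟨ power-of-g s h p≡ pp G<p g≡ G≡ ⟩
          σ ^ h * (+ 1) ^ h        ≡⟨ cong₂ _*_ (cong (_^ h) σ≡-1) (ℤ.^-zeroˡ h) ⟩
          -1ℤ ^ h * 1ℤ             ≡⟨ ℤ.*-identityʳ _ ⟩
          -1ℤ ^ h                  ≡⟨ -1^≡ε h ⟩
          ε h                      ≡⟨ cong ε (ℕ.*-identityˡ q) ⟩
          ε q                      ≡⟨ odd-residue-class K z q≡ 2∤r ⟩
          -1ℤ                      ∎
        where
        open ≡mod-Reasoning (+ p)
        h : ℕ
        h = 2 ℕ.^ 0 ℕ.* q

    case-two : d ≡ 2 → ∀ K → 0 ℕ.< K → (∀ {l} → Prime l → l ℕ.≤ 2 ℕ.* N → l ≢ 2 → l ≢ 3 → l ℕ∣.∣ K) →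
               ¬ 2 ℕ∣.∣ K → ¬ 3 ℕ∣.∣ K → Progression
    case-two refl K 0<K smooth 2∤K 3∤K = from-nonresidue 1 K r smooth 0<K
        -- 4 · 2 = 8, and r₁ must be odd. The choices 1 and 3 fail modulo 3, by 2 + 1 = 3 and 9 + 4
        -- · 3 = 21.
        (residue-coprime 2∤K 3∤K 1 2 5 0 refl 2∤r (from-no (3 ℕ∣.∣? 7)) (from-no (3 ℕ∣.∣? 29)))
        nonresidue-p
      where
      r : ℕ
      r = residue 2∤K 3∤K 1 2 5 0 refl
      2∤r : ¬ 2 ℕ∣.∣ r
      2∤r = ∤-+ˡ {2} {2} (ℕ∣.divides 1 refl) (∤-* {m = 5} prime[2] (from-no (2 ℕ∣.∣? 5))
        (∤-* {n = 1} prime[2] (∤-* prime[2] 2∤K 2∤K) (from-no (2 ℕ∣.∣? 1))))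
      nonresidue-p : ∀ {p q} z → Prime p → p ≡ suc (2 ℕ.* (2 ℕ.^ 1 ℕ.* q)) → q ≡ 6 ℕ.* K ℕ.* z ℕ.+ r → G ℕ.< p →
                     g ^ (2 ℕ.^ 1 ℕ.* q) ≡ -1ℤ [mod + p ]
      nonresidue-p {p} {q} z pp p≡ q≡ G<p = begin
          g ^ h                    ≈⟨ power-of-g s h p≡ pp G<p g≡ G≡ ⟩
          σ ^ h * (+ 2) ^ h        ≡⟨ cong (_* (+ 2) ^ h) (IsSign-even-power q σ±) ⟩
          1ℤ * (+ 2) ^ h           ≡⟨ ℤ.*-identityˡ _ ⟩
          (+ 2) ^ h                ≈⟨ twoPower h {{prime⇒nonZero pp}} p≡ pp q refl ⟩
          ε q                      ≡⟨ odd-residue-class K z q≡ 2∤r ⟩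
          -1ℤ                      ∎
        where
        open ≡mod-Reasoning (+ p)
        h : ℕ
        h = 2 ℕ.^ 1 ℕ.* q

    -- The modulus is 6 K l: v is the class of p modulo `l`, and `K` takes the other primes, up to
    -- 2N + |g| so as to reach every odd prime factor of k.
    module _ (d-free : ∀ {l} → Prime l → ¬ l ℕ.* l ℕ∣.∣ d) {l : ℕ} (j k : ℕ) (l≡1+2j : l ≡ suc (2 ℕ.* j)) (pl : Prime l)
             (d≡k*l : d ≡ k ℕ.* l) (3∣d⇒l≡3 : 3 ℕ∣.∣ d → l ≡ 3)
             {K : ℕ} (0<K : 0 ℕ.< K) (2∤K : ¬ 2 ℕ∣.∣ K) (3∤K : ¬ 3 ℕ∣.∣ K)
             (smooth : ∀ {l′} → Prime l′ → l′ ℕ.≤ 2 ℕ.* N ℕ.+ G → l′ ≢ 2 → l′ ≢ 3 → l′ ≢ l → l′ ℕ∣.∣ K)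
             (t : ℕ) (v^j≡-1 : (+ (9 ℕ.+ 32 ℕ.* (K ℕ.* K ℕ.* (1 ℕ.+ 3 ℕ.* t)))) ^ j ≡ -1ℤ [mod + l ]) where

      private
        v r : ℕ
        v = 9 ℕ.+ 32 ℕ.* (K ℕ.* K ℕ.* (1 ℕ.+ 3 ℕ.* t))
        -- As r₀ = 1, an odd r needs r₁ even; 2 fails because 1 + 2 = 3. The choice 4 yields the 32
        -- = 8 · 4 in v.
        r = residue 2∤K 3∤K 2 1 4 t refl

        v≡1+8r : v ≡ 1 ℕ.+ 8 ℕ.* r
        v≡1+8r = sym (residue-9 2∤K 3∤K 2 1 4 t refl)

        2<l : 2 ℕ.< l
        2<l = oddPrime>2 j pl l≡1+2j

        -- If `l` divided r, then v ≡ 1 would be a residue; coprimality at `l` thus comes from the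
        -- choice of v.
        l∤r : ¬ l ℕ∣.∣ r
        l∤r l∣r = 1≢-1-mod 2<l (≡mod-trans (≡mod-sym (≡mod-trans (^-cong-mod j (pos-mod (ℕ∣.∣n⇒∣m*n 8 l∣r) v≡1+8r))
          (≡mod-reflexive (ℤ.^-zeroˡ j)))) v^j≡-1)

        l∤v : ¬ l ℕ∣.∣ v
        l∤v l∣v = 0^j≢-1 j l≡1+2j (≡mod-trans (≡mod-sym (^-cong-mod j (∣⇒≡0 {a = + v} (∣ᵤ⇒∣ l∣v)))) v^j≡-1)
          where
          0^j≢-1 : ∀ j → l ≡ suc (2 ℕ.* j) → ¬ 0ℤ ^ j ≡ -1ℤ [mod + l ]
          0^j≢-1 zero    l≡1 _ = ¬prime[1] (subst Prime l≡1 pl)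
          0^j≢-1 (suc i) _   e = <⇒∤ ℕ.z<s (ℕ.<-trans (s≤s (s≤s z≤n)) 2<l) (∣⇒∣ᵤ (diff (≡mod-trans (≡mod-reflexive (sym (ℤ.*-zeroˡ (0ℤ ^ i)))) e)))

        coprime-K : ∀ {l′} → Prime l′ → l′ ≡ 2 ⊎ l′ ≡ 3 ⊎ l′ ℕ∣.∣ K → ¬ l′ ℕ∣.∣ r × ¬ l′ ℕ∣.∣ suc (2 ℕ.^ 3 ℕ.* r)
        coprime-K = residue-coprime 2∤K 3∤K 2 1 4 t refl
          (∤-+ʳ {2} {1} (from-no (2 ℕ∣.∣? 1)) (ℕ∣.∣m⇒∣m*n {2} {4} (K ℕ.* K ℕ.* (1 ℕ.+ 3 ℕ.* t)) (ℕ∣.divides 2 refl)))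
          (from-no (3 ℕ∣.∣? 5)) (from-no (3 ℕ∣.∣? 41))

        coprime : ∀ {l′} → Prime l′ → l′ ≡ 2 ⊎ l′ ≡ 3 ⊎ l′ ℕ∣.∣ K ℕ.* l →
                  ¬ l′ ℕ∣.∣ r × ¬ l′ ℕ∣.∣ suc (2 ℕ.^ 3 ℕ.* r)
        coprime pl′ (inj₁ l′≡2)        = coprime-K pl′ (inj₁ l′≡2)
        coprime pl′ (inj₂ (inj₁ l′≡3)) = coprime-K pl′ (inj₂ (inj₁ l′≡3))
        coprime {l′} pl′ (inj₂ (inj₂ l′∣Kl)) = [ (λ l′∣K → coprime-K pl′ (inj₂ (inj₂ l′∣K)))
          , (λ l′∣l → subst (λ x → ¬ x ℕ∣.∣ r × ¬ x ℕ∣.∣ suc (2 ℕ.^ 3 ℕ.* r)) (sym (prime∣prime⇒≡ pl′ pl l′∣l))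
                        (l∤r , subst (λ x → ¬ l ℕ∣.∣ x) v≡1+8r l∤v)) ]′ (euclidsLemma K l pl′ l′∣Kl)

        smooth′ : ∀ {l′} → Prime l′ → l′ ℕ.≤ 2 ℕ.* N → l′ ≢ 2 → l′ ≢ 3 → l′ ℕ∣.∣ K ℕ.* l
        smooth′ {l′} pl′ l′≤ l′≢2 l′≢3 with l′ ℕ.≟ l
        ... | yes refl = ℕ∣.∣n⇒∣m*n K ℕ∣.∣-refl
        ... | no l′≢l  = ℕ∣.∣m⇒∣m*n l (smooth pl′ (ℕ.≤-trans l′≤ (ℕ.m≤m+n _ G)) l′≢2 l′≢3 l′≢l)

        d∣G : d ℕ∣.∣ G
        d∣G = subst (d ℕ∣.∣_) (sym G≡) (ℕ∣.m∣m*n (s ℕ.* s))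
        k∣d : k ℕ∣.∣ d
        k∣d = subst (k ℕ∣.∣_) (sym d≡k*l) (ℕ∣.m∣m*n l)
        l∣d : l ℕ∣.∣ d
        l∣d = subst (l ℕ∣.∣_) (sym d≡k*l) (ℕ∣.n∣m*n k)
        divisor≤G : ∀ {m} → m ℕ∣.∣ d → m ℕ.≤ G
        divisor≤G m∣d = ℕ∣.∣⇒≤ {{ℕ.>-nonZero 0<G}} (ℕ∣.∣-trans m∣d d∣G)
        instance
          k≢0 : NonZero k
          k≢0 = ℕ.≢-nonZero λ { refl → ℕ.<⇒≢ 0<G (sym (trans G≡ (cong (ℕ._* (s ℕ.* s)) d≡k*l))) }

        module _ {p q : ℕ} (z : ℕ) (pp : Prime p) (p≡ : p ≡ suc (2 ℕ.* (2 ℕ.^ 2 ℕ.* q)))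
                 (q≡ : q ≡ 6 ℕ.* (K ℕ.* l) ℕ.* z ℕ.+ r) (G<p : G ℕ.< p) where
          h : ℕ
          h = 2 ℕ.^ 2 ℕ.* q
          h≡ : h ≡ 2 ℕ.* (2 ℕ.* q)
          h≡ = ℕ.*-assoc 2 2 q
          p≡v+ : p ≡ v ℕ.+ 48 ℕ.* K ℕ.* z ℕ.* l
          p≡v+ = trans p≡ (trans (cong (λ x → suc (2 ℕ.* (4 ℕ.* x))) q≡) (trans (expand K l z r) (cong (ℕ._+ 48 ℕ.* K ℕ.* z ℕ.* l) (sym v≡1+8r))))
            where
            expand : ∀ K l z r → 1 ℕ.+ 2 ℕ.* (4 ℕ.* (6 ℕ.* (K ℕ.* l) ℕ.* z ℕ.+ r)) ≡ 1 ℕ.+ 8 ℕ.* r ℕ.+ 48 ℕ.* K ℕ.* z ℕ.* l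
            expand = ℕ-ring
          p≢divisor : ∀ {m} → m ℕ∣.∣ d → p ≢ m
          p≢divisor m∣d refl = ℕ.<⇒≱ G<p (divisor≤G m∣d)

          l-nonresidue : (+ l) ^ h ≡ -1ℤ [mod + p ]
          l-nonresidue = legendre-flip h p≡ pp {l} {j} {2 ℕ.* q} l≡1+2j pl (p≢divisor l∣d) h≡ (inj₂ refl)
            (≡mod-trans (^-cong-mod j (pos-mod (ℕ∣.n∣m*n (48 ℕ.* K ℕ.* z)) p≡v+)) v^j≡-1)

          -- 2 is a residue as p ≡ 1 modulo 8, and the odd primes of `k` are residues as p ≡ 9.
          -- Neither `l` nor 3 divides `k`, by squarefreeness and the choice of `l`.
          k-residue : (+ k) ^ h ≡ 1ℤ [mod + p ]
          k-residue = product-residue h p≡ pp k factor-residue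
            where
            factor-residue : ∀ {l′} → Prime l′ → l′ ℕ∣.∣ k → (+ l′) ^ h ≡ 1ℤ [mod + p ]
            factor-residue {l′} pl′ l′∣k = by-cases (l′ ℕ.≟ 2)
              where
              l′∣d : l′ ℕ∣.∣ d
              l′∣d = ℕ∣.∣-trans l′∣k k∣d
              l′≢l : l′ ≢ l
              l′≢l refl = d-free pl (subst (l ℕ.* l ℕ∣.∣_) (sym d≡k*l) (ℕ∣.*-monoˡ-∣ l l′∣k))
              l′≢3 : l′ ≢ 3
              l′≢3 l′≡3 = l′≢l (trans l′≡3 (sym (3∣d⇒l≡3 (subst (ℕ∣._∣ d) l′≡3 l′∣d))))
              by-cases : Dec (l′ ≡ 2) → (+ l′) ^ h ≡ 1ℤ [mod + p ]
              by-cases (yes refl) = ≡mod-trans (twoPower h {{prime⇒nonZero pp}} p≡ pp (2 ℕ.* q) h≡) (≡mod-reflexive (ε-double q))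
              by-cases (no l′≢2)  = residue-of-9 h p≡ pp {l′} {2 ℕ.* q} pl′ l′≢2 l′≢3 (p≢divisor l′∣d) h≡
                (pos-mod {m = 9} (ℕ∣.∣m∣n⇒∣m+n (ℕ∣.∣n⇒∣m*n 32 (ℕ∣.∣m⇒∣m*n _ (ℕ∣.∣m⇒∣m*n K l′∣K)))
                    (ℕ∣.∣m⇒∣m*n l (ℕ∣.∣m⇒∣m*n z (ℕ∣.∣n⇒∣m*n 48 l′∣K)))) (trans p≡v+ (ℕ.+-assoc 9 (32 ℕ.* (K ℕ.* K ℕ.* (1 ℕ.+ 3 ℕ.* t))) _)))
                where
                l′∣K : l′ ℕ∣.∣ K
                l′∣K = smooth pl′ (ℕ.≤-trans (divisor≤G l′∣d) (ℕ.m≤n+m G (2 ℕ.* N))) l′≢2 l′≢3 l′≢l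

          nonresidue-p : g ^ h ≡ -1ℤ [mod + p ]
          nonresidue-p = begin
            g ^ h                              ≈⟨ power-of-g s h p≡ pp G<p g≡ G≡ ⟩
            σ ^ h * (+ d) ^ h                  ≡⟨ cong (_* (+ d) ^ h) (trans (cong (σ ^_) h≡) (IsSign-even-power (2 ℕ.* q) σ±)) ⟩
            1ℤ * (+ d) ^ h                     ≡⟨ ℤ.*-identityˡ _ ⟩
            (+ d) ^ h                          ≡⟨ cong (_^ h) (trans (cong +_ d≡k*l) (ℤ.pos-* k l)) ⟩
            (+ k * + l) ^ h                    ≡⟨ ^-distribʳ-* (+ k) (+ l) h ⟩
            (+ k) ^ h * (+ l) ^ h              ≈⟨ *-cong-mod k-residue l-nonresidue ⟩
            -1ℤ                                ∎
            where open ≡mod-Reasoning (+ p)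

      case-odd-prime : Progression
      case-odd-prime = from-nonresidue 2 (K ℕ.* l) r smooth′
        (ℕ.*-mono-< 0<K (ℕ.<-trans ℕ.z<s 2<l)) coprime nonresidue-p

-- Choosing the odd prime and concluding.

odd-prime-divisor : ∀ {d} → 0 ℕ.< d → d ≢ 1 → d ≢ 2 → ¬ 4 ℕ∣.∣ d →
                    ∃[ l ] Prime l × l ≢ 2 × l ℕ∣.∣ d
odd-prime-divisor {d} 0<d d≢1 d≢2 4∤d with prime-divisor d {{ℕ.>-nonZero 0<d}} d≢1
... | l , pl , l∣d with l ℕ.≟ 2
...   | no l≢2 = l , pl , l≢2 , l∣d
...   | yes refl = let m , pm , m∣e = prime-divisor e {{e≢0}} e≢1 in m , pm ,
        (λ m≡2 → 4∤d (subst (4 ℕ∣.∣_) (sym d≡e*2) (ℕ∣.*-monoˡ-∣ 2 (subst (ℕ∣._∣ e) m≡2 m∣e)))) ,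
        ℕ∣.∣-trans m∣e (ℕ∣.divides 2 (trans d≡e*2 (ℕ.*-comm e 2)))
  where
  e : ℕ
  e = ℕ∣.quotient l∣d
  d≡e*2 : d ≡ e ℕ.* 2
  d≡e*2 = ℕ∣._∣_.equality l∣d
  e≢1 : e ≢ 1
  e≢1 e≡1 = d≢2 (trans d≡e*2 (cong (ℕ._* 2) e≡1))
  e≢0 : NonZero e
  e≢0 = ℕ.≢-nonZero λ e≡0 → ℕ.<⇒≢ 0<d (sym (trans d≡e*2 (cong (ℕ._* 2) e≡0)))

-- For l = 3 the number is 9 + 32 ≡ -1 anyway. Otherwise it is linear in t with coefficient 96 K²,
-- prime to `l`, so it can be made congruent to any given nonresidue.
nonresidue-lift : ∀ {l} j K → l ≡ suc (2 ℕ.* j) → Prime l → ¬ 3 ℕ∣.∣ K → ¬ l ℕ∣.∣ K →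
  ∃[ t ] (+ (9 ℕ.+ 32 ℕ.* (K ℕ.* K ℕ.* (1 ℕ.+ 3 ℕ.* t)))) ^ j ≡ -1ℤ [mod + l ]
nonresidue-lift {l} j K l≡1+2j pl 3∤K l∤K with l ℕ.≟ 3
... | yes refl = 0 , subst (λ j → v ^ j ≡ -1ℤ [mod + 3 ]) (ℕ.*-cancelˡ-≡ 1 j 2 (ℕ.suc-injective l≡1+2j))
        (≡mod-trans (≡mod-reflexive (ℤ.*-identityʳ v))
          (≡mod-trans (pos-mod (ℕ∣.m∣m*n (13 ℕ.+ 32 ℕ.* f)) (trans (cong (λ x → 9 ℕ.+ 32 ℕ.* (x ℕ.* 1)) K²≡) (expand f)))
            (≡mod-by 1ℤ refl)))
  where
  v : ℤ
  v = + (9 ℕ.+ 32 ℕ.* (K ℕ.* K ℕ.* (1 ℕ.+ 3 ℕ.* 0)))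
  f : ℕ
  f = proj₁ (square-mod-3 3∤K)
  K²≡ : K ℕ.* K ≡ 1 ℕ.+ 3 ℕ.* f
  K²≡ = proj₂ (square-mod-3 3∤K)
  expand : ∀ f → 9 ℕ.+ 32 ℕ.* ((1 ℕ.+ 3 ℕ.* f) ℕ.* 1) ≡ 2 ℕ.+ 3 ℕ.* (13 ℕ.+ 32 ℕ.* f)
  expand = ℕ-ring
... | no l≢3 = let u , u^j≡-1 = nonresidue j l≡1+2j pl
                   t , solves = solve-linear j l≡1+2j pl (9 ℕ.+ 32 ℕ.* (K ℕ.* K)) (32 ℕ.* (3 ℕ.* (K ℕ.* K))) u l∤coefficient
               in t , ≡mod-trans (^-cong-mod j (≡mod-trans (≡mod-reflexive (cong +_ (expand (K ℕ.* K) t))) solves)) u^j≡-1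
  where
  expand : ∀ x t → 9 ℕ.+ 32 ℕ.* (x ℕ.* (1 ℕ.+ 3 ℕ.* t)) ≡ 9 ℕ.+ 32 ℕ.* x ℕ.+ 32 ℕ.* (3 ℕ.* x) ℕ.* t
  expand = ℕ-ring
  l∤coefficient : ¬ l ℕ∣.∣ 32 ℕ.* (3 ℕ.* (K ℕ.* K))
  l∤coefficient = ∤-* pl (prime-power∤ pl (<⇒∤ ℕ.z<s (oddPrime>2 j pl l≡1+2j)) 5)
    (∤-* pl (l≢3 ∘ prime∣prime⇒≡ pl prime[3]) (∤-* pl l∤K l∤K))

theorem2 : (N : ℕ) → 1 ℕ.≤ N → TC (2 ℕ.* N) →
    (g : ℤ) → ¬ (g ≡ -[1+ 0 ]) → ¬ IsSquareℤ g →
    ∃[ A₁ ] ∃[ C₁ ] ((n : ℕ) → 1 ℕ.≤ n → n ℕ.≤ N →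
    Σ ℕ λ p → (A₁ * (+ n) * (+ n) + C₁ ≡ + p) × Prime p × PrimitiveRoot g p)
theorem2 N 1≤N tc g g≢-1 g-nonsquare =
  let σ , σ± , g≡σG = signPart g
      d , s , G≡ , d-free = squarefree-decomposition ∣ g ∣ (0<G N 1≤N tc g g≢-1 g-nonsquare)
  in by-cases s σ± g≡σG G≡ d-free (d ℕ.≟ 1) (d ℕ.≟ 2)
  where
  Goal : Set
  Goal = Progression N 1≤N tc g g≢-1 g-nonsquare

  module _ {σ d} s (σ± : IsSign σ) (g≡σG : g ≡ σ * + ∣ g ∣) (G≡ : ∣ g ∣ ≡ d ℕ.* (s ℕ.* s))
           (d-free : ∀ {l} → Prime l → ¬ l ℕ.* l ℕ∣.∣ d) where

    0<d : 0 ℕ.< d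
    0<d = ℕ.n≢0⇒n>0 λ d≡0 → ℕ.<⇒≢ (0<G N 1≤N tc g g≢-1 g-nonsquare) (sym (trans G≡ (cong (ℕ._* (s ℕ.* s)) d≡0)))

    away-from-6 : (∀ K → 0 ℕ.< K → (∀ {l} → Prime l → l ℕ.≤ 2 ℕ.* N → l ≢ 2 → l ≢ 3 → l ℕ∣.∣ K) →
                   ¬ 2 ℕ∣.∣ K → ¬ 3 ℕ∣.∣ K → Goal) → Goal
    -- The primes 2 and 3 are left out of `K` because the modulus 6 K contains them already.
    away-from-6 goal =
      let K , 0<K , all , none = coprime-primorial (2 ∷ 3 ∷ []) (prime[2] ∷ prime[3] ∷ []) (2 ℕ.* N) in
      goal K 0<K (λ pl l≤ l≢2 l≢3 → all pl l≤ λ { (here l≡2) → l≢2 l≡2 ; (there (here l≡3)) → l≢3 l≡3 })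
        (none (here refl)) (none (there (here refl)))

    at-odd-prime : ∀ {l} → Prime l → l ≢ 2 → l ℕ∣.∣ d → (3 ℕ∣.∣ d → l ≡ 3) → Goal
    at-odd-prime {l} pl l≢2 (ℕ∣.divides k d≡k*l) 3∣d⇒l≡3 =
      let K , 0<K , all , none = coprime-primorial (2 ∷ 3 ∷ l ∷ []) (prime[2] ∷ prime[3] ∷ pl ∷ []) (2 ℕ.* N ℕ.+ ∣ g ∣)
          3∤K = none (there (here refl))
          j , l≡1+2j = oddPrime pl l≢2
          t , v^j≡-1 = nonresidue-lift j K l≡1+2j pl 3∤K (none (there (there (here refl))))
      in case-odd-prime N 1≤N tc g g≢-1 g-nonsquare s σ± g≡σG G≡ d-free j k l≡1+2j pl d≡k*l 3∣d⇒l≡3 0<K (none (here refl)) 3∤K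
           (λ pl′ l≤ l≢2 l≢3 l≢l → all pl′ l≤ λ { (here l≡2) → l≢2 l≡2 ; (there (here l≡3)) → l≢3 l≡3
                                                ; (there (there (here l≡l))) → l≢l l≡l })
           t v^j≡-1

    by-cases : Dec (d ≡ 1) → Dec (d ≡ 2) → Goal
    by-cases (yes d≡1) _         = away-from-6 (case-one N 1≤N tc g g≢-1 g-nonsquare s σ± g≡σG G≡ d≡1)
    by-cases (no _)    (yes d≡2) = away-from-6 (case-two N 1≤N tc g g≢-1 g-nonsquare s σ± g≡σG G≡ d≡2)
    by-cases (no d≢1)  (no d≢2) with 3 ℕ∣.∣? d
    ... | yes 3∣d = at-odd-prime prime[3] (λ ()) 3∣d (λ _ → refl)
    ... | no 3∤d  = let l , pl , l≢2 , l∣d = odd-prime-divisor 0<d d≢1 d≢2 (d-free prime[2]) in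
                    at-odd-prime pl l≢2 l∣d (λ 3∣d → contradiction 3∣d 3∤d)
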